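{- Let $g(t)=\sum_{n\ge0}g_nt^n$ be a real formal power series with $g_0=1$ and $f(t)=\sum_{n\ge1}f_nt^n$ a real formal power series with $f_1\neq0$. Put $z_0=f_1$, $w_0=g_1$ and let \[ Z(t)=\frac{f(t)-z_0t\,g(t)}{f(t)}+z_0=\sum_{k\ge0}z_kt^k,\qquad W(t)=\frac{(1-w_0t)g(t)-1}{f(t)}+w_0=\sum_{k\ge0}w_kt^k . \] Let $J$ be the infinite matrix with $0$th column $(w_0,w_1,w_2,\dots)^T$, $1$st column $(z_0,z_1,z_2,\dots)^T$, entries $J_{i,i+1}=1$ for $i\ge1$, and all other entries $0$. If $J$ is totally positive, then the quasi-Riordan array $[g,f]$ is totally positive.
   Context: The quasi-Riordan array $[g,f]$ is the infinite lower triangular matrix $(r_{n,k})_{n,k\ge0}$ with $r_{n,0}=g_n$ and $r_{n,k}=f_{n-k+1}$ for $k\ge1$ (with $f_j=0$ for $j\le0$); its columns have generating functions $g,f,tf,t^2f,\dots$. The matrix $J$ is called the production matrix of $[g,f]$ (the data $A(t)=1$, $Z$, $W$ being the $A$-, $Z$-, $W$-sequences of $[g,f]$). An infinite matrix is totally positive (TP) if all its minors are nonnegative. -}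

module Defs where

open import Algebra.Bundles using (CommutativeRing)
open import Algebra.Structures using (IsCommutativeRing)
open import Data.Bool.Base using (if_then_else_)
open import Data.Fin.Base as Fin using (Fin; zero; suc; toℕ; punchIn)
open import Data.Nat.Base as ℕ using (ℕ; zero; suc; _∸_; _≡ᵇ_; _≤ᵇ_)
import Data.Fin.Properties as Fin
import Data.Nat.Properties as ℕ
open import Data.Product.Base using (∃; _×_; _,_; proj₁; proj₂)
open import Data.Rational.Base as ℚ using (ℚ; 0ℚ; 1ℚ; ½)
import Data.Rational.Properties as ℚ
import Data.Rational.Solver as ℚ
open import Level using (0ℓ)
open import Relation.Binary.Structures using (IsEquivalence)
open import Relation.Binary.PropositionalEquality using (_≡_; refl; sym; trans; cong; cong₂; subst)
open import Relation.Nullary.Decidable using (yes; no)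
open import Relation.Nullary.Negation using (¬_; contradiction)

------------------------------------------------------------------------
-- Rational estimates

abstract
  dist-+ : ∀ a b c d → (a ℚ.+ b) ℚ.- (c ℚ.+ d) ≡ (a ℚ.- c) ℚ.+ (b ℚ.- d)
  dist-+ = solve 4 (λ a b c d → (a :+ b) :- (c :+ d) := (a :- c) :+ (b :- d)) refl
    where open ℚ.+-*-Solver

  dist-* : ∀ a b c d → (a ℚ.* b) ℚ.- (c ℚ.* d) ≡ a ℚ.* (b ℚ.- d) ℚ.+ d ℚ.* (a ℚ.- c)
  dist-* = solve 4 (λ a b c d → (a :* b) :- (c :* d) := a :* (b :- d) :+ d :* (a :- c)) refl
    where open ℚ.+-*-Solver

  dist-neg : ∀ a b → (ℚ.- a) ℚ.- (ℚ.- b) ≡ ℚ.- (a ℚ.- b)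
  dist-neg = solve 2 (λ a b → (:- a) :- (:- b) := :- (a :- b)) refl
    where open ℚ.+-*-Solver

  dist-trans : ∀ a b c → a ℚ.- c ≡ (a ℚ.- b) ℚ.+ (b ℚ.- c)
  dist-trans = solve 3 (λ a b c → a :- c := (a :- b) :+ (b :- c)) refl
    where open ℚ.+-*-Solver

  dist-sym : ∀ a b → ℚ.∣ a ℚ.- b ∣ ≡ ℚ.∣ b ℚ.- a ∣
  dist-sym a b = trans (cong ℚ.∣_∣ (lemma a b)) (ℚ.∣-p∣≡∣p∣ (b ℚ.- a))
    where
    open ℚ.+-*-Solver
    lemma : ∀ a b → a ℚ.- b ≡ ℚ.- (b ℚ.- a)
    lemma = solve 2 (λ a b → a :- b := :- (b :- a)) refl

  a≡b+[a-b] : ∀ a b → a ≡ b ℚ.+ (a ℚ.- b)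
  a≡b+[a-b] = solve 2 (λ a b → a := b :+ (a :- b)) refl
    where open ℚ.+-*-Solver

  half-pos : ∀ ε → 0ℚ ℚ.< ε → 0ℚ ℚ.< ε ℚ.* ½
  half-pos ε 0<ε = ℚ.positive⁻¹ (ε ℚ.* ½) {{ℚ.pos*pos⇒pos ε {{ℚ.positive 0<ε}} ½}}

  halves : ∀ ε → ε ℚ.* ½ ℚ.+ ε ℚ.* ½ ≡ ε
  halves ε = trans (sym (ℚ.*-distribˡ-+ ε ½ ½)) (ℚ.*-identityʳ ε)

  scaled : ∀ {B ε} → 0ℚ ℚ.< B → 0ℚ ℚ.< ε → ∃ λ δ → 0ℚ ℚ.< δ × B ℚ.* δ ≡ ε
  scaled {B} {ε} 0<B 0<ε = B⁻¹ ℚ.* ε , 0<B⁻¹ε , (begin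
    B ℚ.* (B⁻¹ ℚ.* ε)  ≡⟨ ℚ.*-assoc B B⁻¹ ε ⟨
    B ℚ.* B⁻¹ ℚ.* ε    ≡⟨ cong (ℚ._* ε) (ℚ.*-inverseʳ B {{B≢0}}) ⟩
    1ℚ ℚ.* ε           ≡⟨ ℚ.*-identityˡ ε ⟩
    ε                  ∎)
    where
    open Relation.Binary.PropositionalEquality.≡-Reasoning
    B≢0 : ℚ.NonZero B
    B≢0 = ℚ.pos⇒nonZero B {{ℚ.positive 0<B}}
    B⁻¹ : ℚ
    B⁻¹ = ℚ.1/_ B {{B≢0}}
    0<B⁻¹ε : 0ℚ ℚ.< B⁻¹ ℚ.* ε
    0<B⁻¹ε = ℚ.positive⁻¹ (B⁻¹ ℚ.* ε)
      {{ℚ.pos*pos⇒pos B⁻¹ {{ℚ.1/pos⇒pos B {{ℚ.positive 0<B}}}} ε {{ℚ.positive 0<ε}}}}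

  +-small : ∀ p q ε → ℚ.∣ p ∣ ℚ.< ε ℚ.* ½ → ℚ.∣ q ∣ ℚ.< ε ℚ.* ½ → ℚ.∣ p ℚ.+ q ∣ ℚ.< ε
  +-small p q ε p< q< = begin-strict
    ℚ.∣ p ℚ.+ q ∣            ≤⟨ ℚ.∣p+q∣≤∣p∣+∣q∣ p q ⟩
    ℚ.∣ p ∣ ℚ.+ ℚ.∣ q ∣      <⟨ ℚ.+-mono-< p< q< ⟩
    ε ℚ.* ½ ℚ.+ ε ℚ.* ½      ≡⟨ halves ε ⟩
    ε                        ∎
    where open ℚ.≤-Reasoning

  *-small : ∀ p q {B δ} → 0ℚ ℚ.< B → ℚ.∣ p ∣ ℚ.≤ B → ℚ.∣ q ∣ ℚ.< δ → ℚ.∣ p ℚ.* q ∣ ℚ.< B ℚ.* δ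
  *-small p q {B} {δ} 0<B p≤ q< = begin-strict
    ℚ.∣ p ℚ.* q ∣        ≡⟨ ℚ.∣p*q∣≡∣p∣*∣q∣ p q ⟩
    ℚ.∣ p ∣ ℚ.* ℚ.∣ q ∣  ≤⟨ ℚ.*-monoʳ-≤-nonNeg ℚ.∣ q ∣ {{ℚ.∣-∣-nonNeg q}} p≤ ⟩
    B ℚ.* ℚ.∣ q ∣        <⟨ ℚ.*-monoʳ-<-pos B {{ℚ.positive 0<B}} q< ⟩
    B ℚ.* δ              ∎
    where open ℚ.≤-Reasoning

  +-dist-small : ∀ a b c d ε → ℚ.∣ a ℚ.- c ∣ ℚ.< ε ℚ.* ½ → ℚ.∣ b ℚ.- d ∣ ℚ.< ε ℚ.* ½ →
                 ℚ.∣ (a ℚ.+ b) ℚ.- (c ℚ.+ d) ∣ ℚ.< ε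
  +-dist-small a b c d ε p q =
    subst (λ r → ℚ.∣ r ∣ ℚ.< ε) (sym (dist-+ a b c d)) (+-small (a ℚ.- c) (b ℚ.- d) ε p q)

  neg-dist-small : ∀ a b ε → ℚ.∣ a ℚ.- b ∣ ℚ.< ε → ℚ.∣ (ℚ.- a) ℚ.- (ℚ.- b) ∣ ℚ.< ε
  neg-dist-small a b ε = subst (ℚ._< ε)
    (sym (trans (cong ℚ.∣_∣ (dist-neg a b)) (ℚ.∣-p∣≡∣p∣ (a ℚ.- b))))

  trans-small : ∀ a b c ε → ℚ.∣ a ℚ.- b ∣ ℚ.< ε ℚ.* ½ → ℚ.∣ b ℚ.- c ∣ ℚ.< ε ℚ.* ½ → ℚ.∣ a ℚ.- c ∣ ℚ.< ε
  trans-small a b c ε p q =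
    subst (λ r → ℚ.∣ r ∣ ℚ.< ε) (sym (dist-trans a b c)) (+-small (a ℚ.- b) (b ℚ.- c) ε p q)

  refl-small : ∀ {a b} ε → a ≡ b → 0ℚ ℚ.< ε → ℚ.∣ a ℚ.- b ∣ ℚ.< ε
  refl-small {a} ε refl = subst (ℚ._< ε) (cong ℚ.∣_∣ (sym (ℚ.+-inverseʳ a)))

  *-dist-small : ∀ a b c d ε {B C δ η} → 0ℚ ℚ.< B → 0ℚ ℚ.< C → B ℚ.* δ ≡ ε ℚ.* ½ → C ℚ.* η ≡ ε ℚ.* ½ →
                 ℚ.∣ a ∣ ℚ.≤ B × ℚ.∣ d ∣ ℚ.≤ C → ℚ.∣ b ℚ.- d ∣ ℚ.< δ × ℚ.∣ a ℚ.- c ∣ ℚ.< η →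
                 ℚ.∣ a ℚ.* b ℚ.- c ℚ.* d ∣ ℚ.< ε
  *-dist-small a b c d ε {B} {C} {δ} {η} 0<B 0<C Bδ≡ Cη≡ (a≤B , d≤C) (b-d< , a-c<) =
    subst (λ r → ℚ.∣ r ∣ ℚ.< ε) (sym (dist-* a b c d))
      (+-small (a ℚ.* (b ℚ.- d)) (d ℚ.* (a ℚ.- c)) ε
        (subst (ℚ.∣ a ℚ.* (b ℚ.- d) ∣ ℚ.<_) Bδ≡ (*-small a (b ℚ.- d) {B} {δ} 0<B a≤B b-d<))
        (subst (ℚ.∣ d ℚ.* (a ℚ.- c) ∣ ℚ.<_) Cη≡ (*-small d (a ℚ.- c) {C} {η} 0<C d≤C a-c<)))

------------------------------------------------------------------------
-- The real numbers: Cauchy sequences of rationals, with equality the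
-- setoid relation "the difference tends to 0"

Eventually : (ℕ → Set) → Set
Eventually P = ∃ λ N → ∀ n → N ℕ.≤ n → P n

Eventually₂ : (ℕ → ℕ → Set) → Set
Eventually₂ P = ∃ λ N → ∀ m n → N ℕ.≤ m → N ℕ.≤ n → P m n

ev-map : ∀ {P Q : ℕ → Set} → (∀ n → P n → Q n) → Eventually P → Eventually Q
ev-map h (N , p) = N , λ n l → h n (p n l)

ev₂-map : ∀ {P Q : ℕ → ℕ → Set} → (∀ m n → P m n → Q m n) → Eventually₂ P → Eventually₂ Q
ev₂-map h (N , p) = N , λ m n lm ln → h m n (p m n lm ln)

ev-zip : ∀ {P Q R : ℕ → Set} → (∀ n → P n → Q n → R n) → Eventually P → Eventually Q → Eventually R
ev-zip h (M , p) (N , q) = M ℕ.⊔ N , λ n l →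
  h n (p n (ℕ.m⊔n≤o⇒m≤o M N l)) (q n (ℕ.m⊔n≤o⇒n≤o M N l))

ev₂-zip : ∀ {P Q R : ℕ → ℕ → Set} → (∀ m n → P m n → Q m n → R m n) → Eventually₂ P → Eventually₂ Q → Eventually₂ R
ev₂-zip h (M , p) (N , q) = M ℕ.⊔ N , λ m n lm ln →
  h m n (p m n (ℕ.m⊔n≤o⇒m≤o M N lm) (ℕ.m⊔n≤o⇒m≤o M N ln))
        (q m n (ℕ.m⊔n≤o⇒n≤o M N lm) (ℕ.m⊔n≤o⇒n≤o M N ln))

ev⇒ev₂ : ∀ {P Q : ℕ → Set} → Eventually P → Eventually Q → Eventually₂ λ m n → P m × Q n
ev⇒ev₂ (M , p) (N , q) = M ℕ.⊔ N , λ m n lm ln →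
  p m (ℕ.m⊔n≤o⇒m≤o M N lm) , q n (ℕ.m⊔n≤o⇒n≤o M N ln)

IsCauchy : (ℕ → ℚ) → Set
IsCauchy s = ∀ ε → 0ℚ ℚ.< ε → Eventually₂ λ m n → ℚ.∣ s m ℚ.- s n ∣ ℚ.< ε

record ℝ : Set where
  no-eta-equality
  field
    seq    : ℕ → ℚ
    cauchy : IsCauchy seq

open ℝ public

infix 4 _≈_ _≤_ _#_

-- Wrapped in records so that the endpoints can be inferred.
record _≈_ (x y : ℝ) : Set where
  constructor mk≈
  field
    close : ∀ ε → 0ℚ ℚ.< ε → Eventually λ n → ℚ.∣ seq x n ℚ.- seq y n ∣ ℚ.< ε

record _≤_ (x y : ℝ) : Set where
  constructor mk≤
  field
    below : ∀ ε → 0ℚ ℚ.< ε → Eventually λ n → seq x n ℚ.< seq y n ℚ.+ ε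

open _≈_ public
open _≤_ public

-- Apartness, the constructive form of "x ≠ y".  By #⇒≉ and ¬#⇒≈ below it
-- is classically equivalent to the negation of x ≈ y.
_#_ : ℝ → ℝ → Set
x # y = ∃ λ ε → 0ℚ ℚ.< ε × Eventually λ n → ε ℚ.< ℚ.∣ seq x n ℚ.- seq y n ∣

fromℚ : ℚ → ℝ
fromℚ q .seq _ = q
fromℚ q .cauchy ε 0<ε = 0 , λ _ _ _ _ → refl-small {q} ε refl 0<ε

0ℝ 1ℝ : ℝ
0ℝ = fromℚ 0ℚ
1ℝ = fromℚ 1ℚ

abstract
  bounded : ∀ x → ∃ λ B → 0ℚ ℚ.< B × Eventually λ n → ℚ.∣ seq x n ∣ ℚ.≤ B
  bounded x = B , 0<B , N , λ n N≤n → begin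
    ℚ.∣ seq x n ∣                                  ≡⟨ cong ℚ.∣_∣ (a≡b+[a-b] (seq x n) (seq x N)) ⟩
    ℚ.∣ seq x N ℚ.+ (seq x n ℚ.- seq x N) ∣        ≤⟨ ℚ.∣p+q∣≤∣p∣+∣q∣ (seq x N) _ ⟩
    ℚ.∣ seq x N ∣ ℚ.+ ℚ.∣ seq x n ℚ.- seq x N ∣    ≤⟨ ℚ.+-monoʳ-≤ ℚ.∣ seq x N ∣ (ℚ.<⇒≤ (proj₂ near n N N≤n ℕ.≤-refl)) ⟩
    B                                              ∎
    where
    open ℚ.≤-Reasoning
    near : Eventually₂ λ m n → ℚ.∣ seq x m ℚ.- seq x n ∣ ℚ.< 1ℚ
    near = cauchy x 1ℚ (ℚ.positive⁻¹ 1ℚ)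
    N : ℕ
    N = proj₁ near
    B : ℚ
    B = ℚ.∣ seq x N ∣ ℚ.+ 1ℚ
    0<B : 0ℚ ℚ.< B
    0<B = ℚ.positive⁻¹ B {{ℚ.nonNeg+pos⇒pos ℚ.∣ seq x N ∣ {{ℚ.∣-∣-nonNeg (seq x N)}} 1ℚ}}

  -- A bound B for x together with δ such that B·δ ≡ ε/2.
  HalfScale : ℝ → ℚ → Set
  HalfScale x ε = ∃ λ B → ∃ λ δ → 0ℚ ℚ.< B × 0ℚ ℚ.< δ × B ℚ.* δ ≡ ε ℚ.* ½ × Eventually λ n → ℚ.∣ seq x n ∣ ℚ.≤ B

  halfScale : ∀ x ε → 0ℚ ℚ.< ε → HalfScale x ε
  halfScale x ε 0<ε = step₁ (bounded x)
    where
    step₂ : ∀ {B} → 0ℚ ℚ.< B → Eventually (λ n → ℚ.∣ seq x n ∣ ℚ.≤ B) →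
            (∃ λ δ → 0ℚ ℚ.< δ × B ℚ.* δ ≡ ε ℚ.* ½) → HalfScale x ε
    step₂ {B} 0<B b (δ , 0<δ , Bδ≡) = B , δ , 0<B , 0<δ , Bδ≡ , b

    step₁ : (∃ λ B → 0ℚ ℚ.< B × Eventually λ n → ℚ.∣ seq x n ∣ ℚ.≤ B) → HalfScale x ε
    step₁ (B , 0<B , b) = step₂ {B} 0<B b (scaled {B} {ε ℚ.* ½} 0<B (half-pos ε 0<ε))

infixl 6 _+_ _-_
infixl 7 _*_
infix  8 -_

abstract
  +-cauchy : ∀ x y → IsCauchy λ n → seq x n ℚ.+ seq y n
  +-cauchy x y ε 0<ε =
    ev₂-zip (λ m n → +-dist-small (seq x m) (seq y m) (seq x n) (seq y n) ε)
      (cauchy x (ε ℚ.* ½) (half-pos ε 0<ε)) (cauchy y (ε ℚ.* ½) (half-pos ε 0<ε))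

  neg-cauchy : ∀ x → IsCauchy λ n → ℚ.- seq x n
  neg-cauchy x ε 0<ε = ev₂-map (λ m n → neg-dist-small (seq x m) (seq x n) ε) (cauchy x ε 0<ε)

  *-cauchy : ∀ x y → IsCauchy λ n → seq x n ℚ.* seq y n
  *-cauchy x y ε 0<ε = estimate (halfScale x ε 0<ε) (halfScale y ε 0<ε)
    where
    estimate : HalfScale x ε → HalfScale y ε →
               Eventually₂ λ m n → ℚ.∣ seq x m ℚ.* seq y m ℚ.- seq x n ℚ.* seq y n ∣ ℚ.< ε
    estimate (B , δ , 0<B , 0<δ , Bδ≡ , b) (C , η , 0<C , 0<η , Cη≡ , c) =
      ev₂-zip (λ m n → *-dist-small (seq x m) (seq y m) (seq x n) (seq y n) ε {B} {C} {δ} {η} 0<B 0<C Bδ≡ Cη≡)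
        (ev⇒ev₂ b c) (ev₂-zip (λ _ _ → _,_) (cauchy y δ 0<δ) (cauchy x η 0<η))

_+_ : ℝ → ℝ → ℝ
(x + y) .seq n  = seq x n ℚ.+ seq y n
(x + y) .cauchy = +-cauchy x y

-_ : ℝ → ℝ
(- x) .seq n  = ℚ.- seq x n
(- x) .cauchy = neg-cauchy x

_-_ : ℝ → ℝ → ℝ
x - y = x + (- y)

_*_ : ℝ → ℝ → ℝ
(x * y) .seq n  = seq x n ℚ.* seq y n
(x * y) .cauchy = *-cauchy x y

------------------------------------------------------------------------
-- ℝ is a commutative ring

abstract
  ≗⇒≈ : ∀ {x y} → (∀ n → seq x n ≡ seq y n) → x ≈ y
  ≗⇒≈ eq = mk≈ λ ε 0<ε → 0 , λ n _ → refl-small ε (eq n) 0<ε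

  ≈-isEquivalence : IsEquivalence _≈_
  ≈-isEquivalence = record
    { refl  = ≗⇒≈ λ _ → refl
    ; sym   = λ {x} {y} x≈y → mk≈ λ ε 0<ε →
        ev-map (λ n → subst (ℚ._< ε) (dist-sym (seq x n) (seq y n))) (close x≈y ε 0<ε)
    ; trans = λ {x} {y} {z} x≈y y≈z → mk≈ λ ε 0<ε →
        ev-zip (λ n → trans-small (seq x n) (seq y n) (seq z n) ε)
          (close x≈y (ε ℚ.* ½) (half-pos ε 0<ε)) (close y≈z (ε ℚ.* ½) (half-pos ε 0<ε))
    }

  +-cong : ∀ {x x′ y y′} → x ≈ x′ → y ≈ y′ → x + y ≈ x′ + y′
  +-cong {x} {x′} {y} {y′} x≈ y≈ = mk≈ λ ε 0<ε →
    ev-zip (λ n → +-dist-small (seq x n) (seq y n) (seq x′ n) (seq y′ n) ε)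
      (close x≈ (ε ℚ.* ½) (half-pos ε 0<ε)) (close y≈ (ε ℚ.* ½) (half-pos ε 0<ε))

  -‿cong : ∀ {x y} → x ≈ y → - x ≈ - y
  -‿cong {x} {y} x≈y = mk≈ λ ε 0<ε →
    ev-map (λ n → neg-dist-small (seq x n) (seq y n) ε) (close x≈y ε 0<ε)

  *-cong : ∀ {x x′ y y′} → x ≈ x′ → y ≈ y′ → x * y ≈ x′ * y′
  *-cong {x} {x′} {y} {y′} x≈ y≈ = mk≈ λ ε 0<ε → estimate ε (halfScale x ε 0<ε) (halfScale y′ ε 0<ε)
    where
    estimate : ∀ ε → HalfScale x ε → HalfScale y′ ε →
               Eventually λ n → ℚ.∣ seq x n ℚ.* seq y n ℚ.- seq x′ n ℚ.* seq y′ n ∣ ℚ.< ε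
    estimate ε (B , δ , 0<B , 0<δ , Bδ≡ , b) (C , η , 0<C , 0<η , Cη≡ , c) =
      ev-zip (λ n → *-dist-small (seq x n) (seq y n) (seq x′ n) (seq y′ n) ε {B} {C} {δ} {η} 0<B 0<C Bδ≡ Cη≡)
        (ev-zip (λ _ → _,_) b c) (ev-zip (λ _ → _,_) (close y≈ δ 0<δ) (close x≈ η 0<η))

ℝ-isCommutativeRing : IsCommutativeRing _≈_ _+_ _*_ -_ 0ℝ 1ℝ
ℝ-isCommutativeRing = record
  { isRing = record
    { +-isAbelianGroup = record
      { isGroup = record
        { isMonoid = record
          { isSemigroup = record
            { isMagma = record
              { isEquivalence = ≈-isEquivalence
              ; ∙-cong = +-cong }
            ; assoc = λ x y z → ≗⇒≈ λ n → ℚ.+-assoc (seq x n) (seq y n) (seq z n) }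
          ; identity = (λ x → ≗⇒≈ λ n → ℚ.+-identityˡ (seq x n))
                     , (λ x → ≗⇒≈ λ n → ℚ.+-identityʳ (seq x n)) }
        ; inverse = (λ x → ≗⇒≈ λ n → ℚ.+-inverseˡ (seq x n))
                  , (λ x → ≗⇒≈ λ n → ℚ.+-inverseʳ (seq x n))
        ; ⁻¹-cong = -‿cong }
      ; comm = λ x y → ≗⇒≈ λ n → ℚ.+-comm (seq x n) (seq y n) }
    ; *-cong = *-cong
    ; *-assoc = λ x y z → ≗⇒≈ λ n → ℚ.*-assoc (seq x n) (seq y n) (seq z n)
    ; *-identity = (λ x → ≗⇒≈ λ n → ℚ.*-identityˡ (seq x n))
                 , (λ x → ≗⇒≈ λ n → ℚ.*-identityʳ (seq x n))
    ; distrib = (λ x y z → ≗⇒≈ λ n → ℚ.*-distribˡ-+ (seq x n) (seq y n) (seq z n))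
              , (λ x y z → ≗⇒≈ λ n → ℚ.*-distribʳ-+ (seq x n) (seq y n) (seq z n)) }
  ; *-comm = λ x y → ≗⇒≈ λ n → ℚ.*-comm (seq x n) (seq y n)
  }

ℝ-commutativeRing : CommutativeRing 0ℓ 0ℓ
ℝ-commutativeRing = record { isCommutativeRing = ℝ-isCommutativeRing }

open import Algebra.Properties.Semiring.Sum (CommutativeRing.semiring ℝ-commutativeRing) public
  using (sum; sum-syntax; sum⁺-syntax; sum-cong-≗; sum-init-last)
open import Algebra.Properties.Semiring.Exp (CommutativeRing.semiring ℝ-commutativeRing) public
  using (_^_)

abstract
  #⇒≉ : ∀ {x y} → x # y → ¬ (x ≈ y)
  #⇒≉ (ε , 0<ε , M , far) x≈y =
    ℚ.<-asym (far (M ℕ.⊔ N) (ℕ.m≤m⊔n M N)) (proj₂ (close x≈y ε 0<ε) (M ℕ.⊔ N) (ℕ.m≤n⊔m M N))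
    where
    N : ℕ
    N = proj₁ (close x≈y ε 0<ε)

  ¬#⇒≈ : ∀ {x y} → ¬ (x # y) → x ≈ y
  ¬#⇒≈ {x} {y} ¬x#y = mk≈ λ ε 0<ε → estimate ε 0<ε (cauchy (x - y) (ε ℚ.* ½) (half-pos ε 0<ε))
    where
    d : ℕ → ℚ
    d n = seq x n ℚ.- seq y n

    far : ∀ ε m n → ℚ.∣ d n ℚ.- d m ∣ ℚ.< ε ℚ.* ½ → ε ℚ.≤ ℚ.∣ d n ∣ → ε ℚ.* ½ ℚ.< ℚ.∣ d m ∣
    far ε m n near ε≤ = ℚ.≰⇒> λ dm≤ → ℚ.<-irrefl refl (begin-strict
      ε                                    ≤⟨ ε≤ ⟩
      ℚ.∣ d n ∣                            ≡⟨ cong ℚ.∣_∣ (a≡b+[a-b] (d n) (d m)) ⟩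
      ℚ.∣ d m ℚ.+ (d n ℚ.- d m) ∣          ≤⟨ ℚ.∣p+q∣≤∣p∣+∣q∣ (d m) (d n ℚ.- d m) ⟩
      ℚ.∣ d m ∣ ℚ.+ ℚ.∣ d n ℚ.- d m ∣      <⟨ ℚ.+-mono-≤-< dm≤ near ⟩
      ε ℚ.* ½ ℚ.+ ε ℚ.* ½                  ≡⟨ halves ε ⟩
      ε                                    ∎)
      where open ℚ.≤-Reasoning

    estimate : ∀ ε → 0ℚ ℚ.< ε → (Eventually₂ λ m n → ℚ.∣ d m ℚ.- d n ∣ ℚ.< ε ℚ.* ½) →
               Eventually λ n → ℚ.∣ d n ∣ ℚ.< ε
    estimate ε 0<ε (N , near) = N , λ n N≤n → ℚ.≰⇒> λ ε≤ →
      ¬x#y (ε ℚ.* ½ , half-pos ε 0<ε , N , λ m N≤m → far ε m n (near n m N≤n N≤m) ε≤)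

------------------------------------------------------------------------
-- Inverses of reals apart from 0

-- The value at 0 is irrelevant: a sequence representing a real apart
-- from 0 is eventually nonzero.
recip : ℚ → ℚ
recip q with q ℚ.≟ 0ℚ
... | yes _  = 0ℚ
... | no q≢0 = ℚ.1/_ q {{ℚ.≢-nonZero q≢0}}

abstract
  recip-inverseʳ : ∀ {ε} q → 0ℚ ℚ.< ε → ε ℚ.< ℚ.∣ q ℚ.- 0ℚ ∣ → q ℚ.* recip q ≡ 1ℚ
  recip-inverseʳ q 0<ε ε< with q ℚ.≟ 0ℚ
  ... | yes refl = contradiction (ℚ.<-trans 0<ε ε<) (ℚ.<-irrefl refl)
  ... | no q≢0  = ℚ.*-inverseʳ q {{ℚ.≢-nonZero q≢0}}

  recip-bound : ∀ {ε η} q → 0ℚ ℚ.< ε → ε ℚ.* η ≡ 1ℚ → ε ℚ.< ℚ.∣ q ℚ.- 0ℚ ∣ → ℚ.∣ recip q ∣ ℚ.≤ η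
  recip-bound {ε} {η} q 0<ε εη≡1 ε< = ℚ.*-cancelˡ-≤-pos ε {{ℚ.positive 0<ε}} (begin
    ε ℚ.* ℚ.∣ recip q ∣          ≤⟨ ℚ.*-monoʳ-≤-nonNeg ℚ.∣ recip q ∣ {{ℚ.∣-∣-nonNeg (recip q)}} (ℚ.<⇒≤ ε<) ⟩
    ℚ.∣ q ℚ.- 0ℚ ∣ ℚ.* ℚ.∣ recip q ∣ ≡⟨ cong (λ r → ℚ.∣ r ∣ ℚ.* ℚ.∣ recip q ∣) (ℚ.+-identityʳ q) ⟩
    ℚ.∣ q ∣ ℚ.* ℚ.∣ recip q ∣    ≡⟨ ℚ.∣p*q∣≡∣p∣*∣q∣ q (recip q) ⟨
    ℚ.∣ q ℚ.* recip q ∣          ≡⟨ cong ℚ.∣_∣ (recip-inverseʳ q 0<ε ε<) ⟩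
    1ℚ                           ≡⟨ εη≡1 ⟨
    ε ℚ.* η                      ∎)
    where open ℚ.≤-Reasoning

  recip-diff : ∀ p q → p ℚ.* recip p ≡ 1ℚ → q ℚ.* recip q ≡ 1ℚ →
               recip p ℚ.- recip q ≡ recip p ℚ.* (recip q ℚ.* (q ℚ.- p))
  recip-diff p q p≡ q≡ = begin
    recip p ℚ.- recip q                                        ≡⟨ cong₂ ℚ._-_ (ℚ.*-identityʳ (recip p)) (ℚ.*-identityʳ (recip q)) ⟨
    recip p ℚ.* 1ℚ ℚ.- recip q ℚ.* 1ℚ                          ≡⟨ cong₂ (λ a b → recip p ℚ.* a ℚ.- recip q ℚ.* b) (sym q≡) (sym p≡) ⟩
    recip p ℚ.* (q ℚ.* recip q) ℚ.- recip q ℚ.* (p ℚ.* recip p) ≡⟨ lemma p q (recip p) (recip q) ⟩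
    recip p ℚ.* (recip q ℚ.* (q ℚ.- p))                        ∎
    where
    open Relation.Binary.PropositionalEquality.≡-Reasoning
    open ℚ.+-*-Solver
    lemma : ∀ p q a b → a ℚ.* (q ℚ.* b) ℚ.- b ℚ.* (p ℚ.* a) ≡ a ℚ.* (b ℚ.* (q ℚ.- p))
    lemma = solve 4 (λ p q a b → a :* (q :* b) :- b :* (p :* a) := a :* (b :* (q :- p))) refl

  recip-dist-small : ∀ p q {ε η θ θ₁ θ₂} → 0ℚ ℚ.< ε → 0ℚ ℚ.< η → ε ℚ.* η ≡ 1ℚ →
                     η ℚ.* θ₁ ≡ θ → η ℚ.* θ₂ ≡ θ₁ →
                     ε ℚ.< ℚ.∣ p ℚ.- 0ℚ ∣ × ε ℚ.< ℚ.∣ q ℚ.- 0ℚ ∣ → ℚ.∣ p ℚ.- q ∣ ℚ.< θ₂ →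
                     ℚ.∣ recip p ℚ.- recip q ∣ ℚ.< θ
  recip-dist-small p q {ε} {η} {θ} {θ₁} {θ₂} 0<ε 0<η εη≡1 ηθ₁≡ ηθ₂≡ (p# , q#) p-q< =
    subst (λ r → ℚ.∣ r ∣ ℚ.< θ)
      (sym (recip-diff p q (recip-inverseʳ p 0<ε p#) (recip-inverseʳ q 0<ε q#)))
      (subst (ℚ.∣ recip p ℚ.* (recip q ℚ.* (q ℚ.- p)) ∣ ℚ.<_) ηθ₁≡
        (*-small (recip p) (recip q ℚ.* (q ℚ.- p)) {η} {θ₁} 0<η (recip-bound {ε} {η} p 0<ε εη≡1 p#)
          (subst (ℚ.∣ recip q ℚ.* (q ℚ.- p) ∣ ℚ.<_) ηθ₂≡
            (*-small (recip q) (q ℚ.- p) {η} {θ₂} 0<η (recip-bound {ε} {η} q 0<ε εη≡1 q#)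
              (subst (ℚ._< θ₂) (dist-sym p q) p-q<)))))

  inv-cauchy : ∀ x → x # 0ℝ → IsCauchy λ n → recip (seq x n)
  inv-cauchy x (ε , 0<ε , apart) θ 0<θ = step₁ (scaled {ε} {1ℚ} 0<ε (ℚ.positive⁻¹ 1ℚ))
    where
    Goal : Set
    Goal = Eventually₂ λ m n → ℚ.∣ recip (seq x m) ℚ.- recip (seq x n) ∣ ℚ.< θ

    step₃ : ∀ {η θ₁} → 0ℚ ℚ.< η → ε ℚ.* η ≡ 1ℚ → η ℚ.* θ₁ ≡ θ →
            (∃ λ θ₂ → 0ℚ ℚ.< θ₂ × η ℚ.* θ₂ ≡ θ₁) → Goal
    step₃ {η} {θ₁} 0<η εη≡1 ηθ₁≡ (θ₂ , 0<θ₂ , ηθ₂≡) =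
      ev₂-zip (λ m n → recip-dist-small (seq x m) (seq x n) {ε} {η} {θ} {θ₁} {θ₂} 0<ε 0<η εη≡1 ηθ₁≡ ηθ₂≡)
        (ev⇒ev₂ apart apart) (cauchy x θ₂ 0<θ₂)

    step₂ : ∀ {η} → 0ℚ ℚ.< η → ε ℚ.* η ≡ 1ℚ → (∃ λ θ₁ → 0ℚ ℚ.< θ₁ × η ℚ.* θ₁ ≡ θ) → Goal
    step₂ {η} 0<η εη≡1 (θ₁ , 0<θ₁ , ηθ₁≡) = step₃ {η} {θ₁} 0<η εη≡1 ηθ₁≡ (scaled {η} {θ₁} 0<η 0<θ₁)

    step₁ : (∃ λ η → 0ℚ ℚ.< η × ε ℚ.* η ≡ 1ℚ) → Goal
    step₁ (η , 0<η , εη≡1) = step₂ {η} 0<η εη≡1 (scaled {η} {θ} 0<η 0<θ)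

inv : (x : ℝ) → x # 0ℝ → ℝ
inv x x#0 .seq n  = recip (seq x n)
inv x x#0 .cauchy = inv-cauchy x x#0

abstract
  inv-inverseʳ : ∀ x (x#0 : x # 0ℝ) → x * inv x x#0 ≈ 1ℝ
  inv-inverseʳ x (ε , 0<ε , N , apart) = mk≈ λ θ 0<θ → N , λ n N≤n →
    refl-small θ (recip-inverseʳ (seq x n) 0<ε (apart n N≤n)) 0<θ

------------------------------------------------------------------------
-- Formal power series, as coefficient sequences

Series : Set
Series = ℕ → ℝ

infix  4 _≈ₛ_
infixl 6 _+ₛ_ _-ₛ_
infixl 7 _*ₛ_

_≈ₛ_ : Series → Series → Set
a ≈ₛ b = ∀ n → a n ≈ b n

const : ℝ → Series
const c zero    = c
const c (suc _) = 0ℝ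

𝑡 : Series
𝑡 n = if n ≡ᵇ 1 then 1ℝ else 0ℝ

_+ₛ_ _-ₛ_ _*ₛ_ : Series → Series → Series
(a +ₛ b) n = a n + b n
(a -ₛ b) n = a n - b n
(a *ₛ b) n = ∑[ i ≤ n ] (a (toℕ i) * b (n ∸ toℕ i))

-- Long division by a series h whose constant term has inverse u:
-- the quotient has constant term a₀u, and its tail is
-- the quotient of (a - a₀u·h)/𝑡 by h.
divide : (h : Series) (u : ℝ) → Series → Series
divide h u a zero    = a 0 * u
divide h u a (suc n) = divide h u (λ k → a (suc k) - a 0 * u * h (suc k)) n

-- The quotient a/f of two series with zero constant term, where f has
-- order 1: both are divided by 𝑡 first.  See quotient-* below.
quotient : (a f : Series) → f 1 # 0ℝ → Series
quotient a f f₁#0 = divide (λ n → f (suc n)) (inv (f 1) f₁#0) (λ n → a (suc n))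

module R = CommutativeRing ℝ-commutativeRing

divide-* : ∀ h u → h 0 * u ≈ 1ℝ → ∀ a → divide h u a *ₛ h ≈ₛ a
divide-* h u hu≈1 a zero = begin
  a 0 * u * h 0 + 0ℝ  ≈⟨ R.+-identityʳ (a 0 * u * h 0) ⟩
  a 0 * u * h 0       ≈⟨ R.*-assoc (a 0) u (h 0) ⟩
  a 0 * (u * h 0)     ≈⟨ R.*-congˡ (R.trans (R.*-comm u (h 0)) hu≈1) ⟩
  a 0 * 1ℝ            ≈⟨ R.*-identityʳ (a 0) ⟩
  a 0                 ∎
  where open import Relation.Binary.Reasoning.Setoid R.setoid
divide-* h u hu≈1 a (suc n) = begin
  c + (divide h u a′ *ₛ h) n   ≈⟨ R.+-congˡ (divide-* h u hu≈1 a′ n) ⟩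
  c + (a (suc n) - c)          ≈⟨ ≗⇒≈ (λ k → sym (a≡b+[a-b] (seq (a (suc n)) k) (seq c k))) ⟩
  a (suc n)                    ∎
  where
  open import Relation.Binary.Reasoning.Setoid R.setoid
  c = a 0 * u * h (suc n)
  a′ : Series
  a′ k = a (suc k) - a 0 * u * h (suc k)

quotient-* : ∀ a f (f₁#0 : f 1 # 0ℝ) → a 0 ≈ 0ℝ → f 0 ≈ 0ℝ → quotient a f f₁#0 *ₛ f ≈ₛ a
quotient-* a f f₁#0 a₀≈0 f₀≈0 zero = begin
  q 0 * f 0 + 0ℝ  ≈⟨ R.+-identityʳ (q 0 * f 0) ⟩
  q 0 * f 0       ≈⟨ R.*-congˡ f₀≈0 ⟩
  q 0 * 0ℝ        ≈⟨ R.zeroʳ (q 0) ⟩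
  0ℝ              ≈⟨ a₀≈0 ⟨
  a 0             ∎
  where
  open import Relation.Binary.Reasoning.Setoid R.setoid
  q = quotient a f f₁#0
quotient-* a f f₁#0 a₀≈0 f₀≈0 (suc n) = begin
  sum c                                  ≈⟨ sum-init-last c ⟩
  sum (λ i → c (Fin.inject₁ i)) + c l    ≡⟨ cong (_+ c l) (sum-cong-≗ init≡) ⟩
  (q *ₛ h) n + c l                       ≈⟨ R.+-cong (divide-* h u (inv-inverseʳ (f 1) f₁#0) (λ k → a (suc k)) n) last≈0 ⟩
  a (suc n) + 0ℝ                         ≈⟨ R.+-identityʳ (a (suc n)) ⟩
  a (suc n)                              ∎
  where
  open import Relation.Binary.Reasoning.Setoid R.setoid
  q h : Series
  q = quotient a f f₁#0
  h k = f (suc k)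
  u = inv (f 1) f₁#0
  c : Fin (suc (suc n)) → ℝ
  c i = q (toℕ i) * f (suc n ∸ toℕ i)
  l = Fin.fromℕ (suc n)
  init≡ : ∀ i → c (Fin.inject₁ i) ≡ q (toℕ i) * h (n ∸ toℕ i)
  init≡ i = trans (cong (λ k → q k * f (suc n ∸ k)) (Fin.toℕ-inject₁ i))
                  (cong (λ k → q (toℕ i) * f k) (ℕ.+-∸-assoc 1 (Fin.toℕ≤pred[n] i)))
  last≈0 : c l ≈ 0ℝ
  last≈0 = begin
    c l                              ≡⟨ cong (λ k → q k * f (suc n ∸ k)) (Fin.toℕ-fromℕ (suc n)) ⟩
    q (suc n) * f (suc n ∸ suc n)    ≡⟨ cong (λ k → q (suc n) * f k) (ℕ.n∸n≡0 n) ⟩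
    q (suc n) * f 0                  ≈⟨ R.*-congˡ f₀≈0 ⟩
    q (suc n) * 0ℝ                   ≈⟨ R.zeroʳ (q (suc n)) ⟩
    0ℝ                               ∎

------------------------------------------------------------------------
-- Total positivity

Matrix : Set
Matrix = ℕ → ℕ → ℝ

-- Laplace expansion along the first row.
det : ∀ {k} → (Fin k → Fin k → ℝ) → ℝ
det {zero}  A = 1ℝ
det {suc k} A = ∑[ j < suc k ] ((- 1ℝ) ^ toℕ j * A zero j * det (λ i l → A (suc i) (punchIn j l)))

StrictlyIncreasing : ∀ {k} → (Fin k → ℕ) → Set
StrictlyIncreasing r = ∀ {i j} → i Fin.< j → r i ℕ.< r j

TotallyPositive : Matrix → Set
TotallyPositive M = ∀ {k} (rows cols : Fin k → ℕ) → StrictlyIncreasing rows → StrictlyIncreasing cols →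
  0ℝ ≤ det (λ i j → M (rows i) (cols j))

------------------------------------------------------------------------
-- Quasi-Riordan arrays and their production matrices

-- The entry in column k + 1 is f_{n-k}, which is 0 for n < k.
quasiRiordan : (g f : Series) → Matrix
quasiRiordan g f n zero    = g n
quasiRiordan g f n (suc k) = if k ≤ᵇ n then f (n ∸ k) else 0ℝ

Z-series W-series : (g f : Series) → f 1 # 0ℝ → Series
Z-series g f f₁#0 = quotient (f -ₛ const z₀ *ₛ 𝑡 *ₛ g) f f₁#0 +ₛ const z₀
  where z₀ = f 1
W-series g f f₁#0 = quotient ((const 1ℝ -ₛ const w₀ *ₛ 𝑡) *ₛ g -ₛ const 1ℝ) f f₁#0 +ₛ const w₀
  where w₀ = g 1

productionMatrix : (g f : Series) → f 1 # 0ℝ → Matrix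
productionMatrix g f f₁#0 i zero          = W-series g f f₁#0 i
productionMatrix g f f₁#0 i (suc zero)    = Z-series g f f₁#0 i
productionMatrix g f f₁#0 i (suc (suc k)) = if i ≡ᵇ suc k then 1ℝ else 0ℝ

{-# OPTIONS --safe #-}

-- Let R = [g, f].  Row 0 of R is (1, 0, 0, …), and the definitions of Z and W say exactly
-- that row n + 1 of R is row n times J.  A minor of R whose rows are all positive is therefore,
-- by Cauchy–Binet, a sum of products of minors of J with minors of R on rows shifted up by one;
-- a minor using row 0 is R₀ₘ times such a minor.  Induction on the largest row gives the claim.
--
-- Cauchy–Binet for AB is proved by induction on the inner dimension: splitting off the first
-- column u of A and the first row v of B is a rank-one update det (uvᵀ + M), whose correction
-- term is expanded along u and v.

module Submission where

open import Defs
open import Data.Bool.Base using (if_then_else_)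
open import Data.Fin.Base as Fin using (Fin; zero; suc; toℕ; punchIn)
open import Data.Nat.Base as ℕ using (ℕ; zero; suc; _≡ᵇ_; z≤n; s≤s)
import Data.Nat.Properties as ℕ
open import Data.Product.Base using (∃; _×_; _,_)
open import Data.Rational.Base as ℚ using (0ℚ; 1ℚ; ½)
import Data.Rational.Properties as ℚ
import Data.Rational.Solver as ℚ
open import Data.Sum.Base using (inj₁; inj₂)
open import Data.Vec.Functional using ([]; _∷_)
open import Function.Base using (_∘_)
open import Relation.Nullary.Decidable using (yes; no)
open import Relation.Binary.PropositionalEquality using (_≡_; _≗_; refl; sym; trans; cong; subst; subst₂)
open import Algebra.Properties.Semiring.Sum R.semiring using (sum-cong-≋; sum-replicate-zero; *-distribˡ-sum)

-- Nonnegative reals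

p≤∣p∣ : ∀ p → p ℚ.≤ ℚ.∣ p ∣
p≤∣p∣ p with ℚ.≤-total 0ℚ p
... | inj₁ 0≤p = ℚ.≤-reflexive (sym (ℚ.0≤p⇒∣p∣≡p 0≤p))
... | inj₂ p≤0 = ℚ.≤-trans p≤0 (ℚ.0≤∣p∣ p)

∣p∣<ε⇒0<p+ε : ∀ p {ε} → ℚ.∣ p ∣ ℚ.< ε → 0ℚ ℚ.< p ℚ.+ ε
∣p∣<ε⇒0<p+ε p {ε} ∣p∣<ε = begin-strict
  0ℚ                 ≡⟨ ℚ.+-inverseʳ p ⟨
  p ℚ.+ (ℚ.- p)      ≤⟨ ℚ.+-monoʳ-≤ p (p≤∣p∣ (ℚ.- p)) ⟩
  p ℚ.+ ℚ.∣ ℚ.- p ∣  ≡⟨ cong (p ℚ.+_) (ℚ.∣-p∣≡∣p∣ p) ⟩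
  p ℚ.+ ℚ.∣ p ∣      <⟨ ℚ.+-monoʳ-< p ∣p∣<ε ⟩
  p ℚ.+ ε            ∎
  where open ℚ.≤-Reasoning

0<p+ε⇒∣p∣<ε : ∀ p {ε} → p ℚ.≤ 0ℚ → 0ℚ ℚ.< p ℚ.+ ε → ℚ.∣ p ∣ ℚ.< ε
0<p+ε⇒∣p∣<ε p {ε} p≤0 0<p+ε = begin-strict
  ℚ.∣ p ∣                ≡⟨ ℚ.∣-p∣≡∣p∣ p ⟨
  ℚ.∣ ℚ.- p ∣            ≡⟨ ℚ.0≤p⇒∣p∣≡p (ℚ.neg-antimono-≤ p≤0) ⟩
  ℚ.- p                  ≡⟨ ℚ.+-identityʳ (ℚ.- p) ⟨
  ℚ.- p ℚ.+ 0ℚ           <⟨ ℚ.+-monoʳ-< (ℚ.- p) 0<p+ε ⟩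
  ℚ.- p ℚ.+ (p ℚ.+ ε)    ≡⟨ solve 2 (λ p ε → :- p :+ (p :+ ε) := ε) refl p ε ⟩
  ε                      ∎
  where
  open ℚ.≤-Reasoning
  open ℚ.+-*-Solver

0≤-resp-≈ : ∀ {x y} → x ≈ y → 0ℝ ≤ x → 0ℝ ≤ y
0≤-resp-≈ {x} {y} x≈y 0≤x = mk≤ λ ε 0<ε →
  ev-zip (λ n → estimate (seq x n) (seq y n) ε)
    (below 0≤x (ε ℚ.* ½) (half-pos ε 0<ε)) (close (R.sym x≈y) (ε ℚ.* ½) (half-pos ε 0<ε))
  where
  estimate : ∀ p q ε → 0ℚ ℚ.< p ℚ.+ ε ℚ.* ½ → ℚ.∣ q ℚ.- p ∣ ℚ.< ε ℚ.* ½ → 0ℚ ℚ.< q ℚ.+ ε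
  estimate p q ε 0<p q-p< = subst (0ℚ ℚ.<_)
    (trans (solve 3 (λ p q h → p :+ h :+ (q :- p :+ h) := q :+ (h :+ h)) refl p q (ε ℚ.* ½))
           (cong (q ℚ.+_) (halves ε)))
    (ℚ.+-mono-< 0<p (∣p∣<ε⇒0<p+ε (q ℚ.- p) q-p<))
    where open ℚ.+-*-Solver

0≤0 : 0ℝ ≤ 0ℝ
0≤0 = mk≤ λ ε 0<ε → 0 , λ _ _ → subst (0ℚ ℚ.<_) (sym (ℚ.+-identityˡ ε)) 0<ε

0≤1 : 0ℝ ≤ 1ℝ
0≤1 = mk≤ λ ε 0<ε → 0 , λ _ _ → ℚ.+-mono-< (ℚ.positive⁻¹ 1ℚ) 0<ε

0≤-+ : ∀ {x y} → 0ℝ ≤ x → 0ℝ ≤ y → 0ℝ ≤ x + y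
0≤-+ {x} {y} 0≤x 0≤y = mk≤ λ ε 0<ε →
  ev-zip (λ n p q → subst (0ℚ ℚ.<_) (regroup (seq x n) (seq y n) ε) (ℚ.+-mono-< p q))
    (below 0≤x (ε ℚ.* ½) (half-pos ε 0<ε)) (below 0≤y (ε ℚ.* ½) (half-pos ε 0<ε))
  where
  regroup : ∀ p q ε → p ℚ.+ ε ℚ.* ½ ℚ.+ (q ℚ.+ ε ℚ.* ½) ≡ p ℚ.+ q ℚ.+ ε
  regroup p q ε = trans
    (solve 3 (λ p q h → p :+ h :+ (q :+ h) := p :+ q :+ (h :+ h)) refl p q (ε ℚ.* ½))
    (cong (p ℚ.+ q ℚ.+_) (halves ε))
    where open ℚ.+-*-Solver

-- The signs of the rational approximants decide the case. An approximant that is at most 0 lies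
-- within a small tolerance of 0 while the other is bounded, so the product is small in absolute
-- value; otherwise both are nonnegative.
0≤-* : ∀ {x y} → 0ℝ ≤ x → 0ℝ ≤ y → 0ℝ ≤ x * y
0≤-* {x} {y} 0≤x 0≤y = mk≤ λ ε 0<ε → bound ε 0<ε (bounded x) (bounded y)
  where
  Bounded : ℝ → Set
  Bounded z = ∃ λ B → 0ℚ ℚ.< B × Eventually λ n → ℚ.∣ seq z n ∣ ℚ.≤ B

  small : ∀ p q {B δ ε} → 0ℚ ℚ.< B → B ℚ.* δ ≡ ε → ℚ.∣ p ∣ ℚ.≤ B → q ℚ.≤ 0ℚ → 0ℚ ℚ.< q ℚ.+ δ →
          0ℚ ℚ.< p ℚ.* q ℚ.+ ε
  small p q {B} {δ} 0<B refl p≤B q≤0 0<q+δ =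
    ∣p∣<ε⇒0<p+ε (p ℚ.* q) (*-small p q {B} {δ} 0<B p≤B (0<p+ε⇒∣p∣<ε q q≤0 0<q+δ))

  estimate : ∀ p q {B C δ η ε} → 0ℚ ℚ.< ε → 0ℚ ℚ.< B → 0ℚ ℚ.< C → B ℚ.* δ ≡ ε → C ℚ.* η ≡ ε →
             ℚ.∣ p ∣ ℚ.≤ B × ℚ.∣ q ∣ ℚ.≤ C → 0ℚ ℚ.< p ℚ.+ η × 0ℚ ℚ.< q ℚ.+ δ → 0ℚ ℚ.< p ℚ.* q ℚ.+ ε
  estimate p q {B} {C} {δ} {η} {ε} 0<ε 0<B 0<C Bδ≡ Cη≡ (p≤B , q≤C) (0<p , 0<q)
    with ℚ.≤-total 0ℚ p | ℚ.≤-total 0ℚ q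
  ... | _        | inj₂ q≤0 = small p q 0<B Bδ≡ p≤B q≤0 0<q
  ... | inj₂ p≤0 | _        =
    subst (λ r → 0ℚ ℚ.< r ℚ.+ ε) (ℚ.*-comm q p) (small q p 0<C Cη≡ q≤C p≤0 0<p)
  ... | inj₁ 0≤p | inj₁ 0≤q = ℚ.+-mono-≤-<
    (ℚ.nonNegative⁻¹ (p ℚ.* q)
      {{ℚ.nonNeg*nonNeg⇒nonNeg p {{ℚ.nonNegative 0≤p}} q {{ℚ.nonNegative 0≤q}}}}) 0<ε

  bound : ∀ ε → 0ℚ ℚ.< ε → Bounded x → Bounded y → Eventually λ n → 0ℚ ℚ.< seq x n ℚ.* seq y n ℚ.+ ε
  bound ε 0<ε (B , 0<B , b) (C , 0<C , c) with scaled {B} {ε} 0<B 0<ε | scaled {C} {ε} 0<C 0<ε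
  ... | δ , 0<δ , Bδ≡ | η , 0<η , Cη≡ =
    ev-zip (λ n → estimate (seq x n) (seq y n) {B} {C} {δ} {η} 0<ε 0<B 0<C Bδ≡ Cη≡)
      (ev-zip (λ _ → _,_) b c) (ev-zip (λ _ → _,_) (below 0≤x η 0<η) (below 0≤y δ 0<δ))

-- Alternating sums

open import Relation.Binary.Reasoning.Setoid R.setoid
open import Algebra.Properties.Ring R.ring using (-1*x≈-x; -‿distribʳ-*)

-- Abstract, so that unification can solve for the implicit length and the argument of alt.
abstract
  alt : ∀ {n} → (Fin n → ℝ) → ℝ
  alt {zero}  x = 0ℝ
  alt {suc n} x = x zero - alt (x ∘ suc)

  alt-empty : (x : Fin 0 → ℝ) → alt x ≈ 0ℝ
  alt-empty x = R.refl

  alt-suc : ∀ {n} (x : Fin (suc n) → ℝ) → alt x ≈ x zero - alt (x ∘ suc)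
  alt-suc x = R.refl

  alt-singleton : (x : Fin 1 → ℝ) → alt x ≈ x zero
  alt-singleton x = ≗⇒≈ λ n → ℚ.+-identityʳ (seq (x zero) n)

  alt-cong : ∀ {n} {x y : Fin n → ℝ} → (∀ i → x i ≈ y i) → alt x ≈ alt y
  alt-cong {zero}  eq = R.refl
  alt-cong {suc n} eq = R.+-cong (eq zero) (R.-‿cong (alt-cong (eq ∘ suc)))

  alt-+ : ∀ {n} (x y : Fin n → ℝ) → alt (λ i → x i + y i) ≈ alt x + alt y
  alt-+ {zero}  x y = R.sym (R.+-identityʳ 0ℝ)
  alt-+ {suc n} x y = R.trans (R.+-congˡ (R.-‿cong (alt-+ (x ∘ suc) (y ∘ suc))))
    (≗⇒≈ λ n → solve 4 (λ a b c d → a :+ b :- (c :+ d) := (a :- c) :+ (b :- d)) refl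
      (seq (x zero) n) (seq (y zero) n) (seq (alt (x ∘ suc)) n) (seq (alt (y ∘ suc)) n))
    where open ℚ.+-*-Solver

  alt-* : ∀ {n} c (x : Fin n → ℝ) → alt (λ i → c * x i) ≈ c * alt x
  alt-* {zero}  c x = R.sym (R.zeroʳ c)
  alt-* {suc n} c x = R.trans (R.+-congˡ (R.-‿cong (alt-* c (x ∘ suc))))
    (≗⇒≈ λ n → solve 3 (λ c a b → c :* a :- c :* b := c :* (a :- b)) refl
      (seq c n) (seq (x zero) n) (seq (alt (x ∘ suc)) n))
    where open ℚ.+-*-Solver

alt-neg : ∀ {n} (x : Fin n → ℝ) → alt (λ i → - x i) ≈ - alt x
alt-neg x = begin
  alt (λ i → - x i)       ≈⟨ alt-cong (λ i → -1*x≈-x (x i)) ⟨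
  alt (λ i → - 1ℝ * x i)  ≈⟨ alt-* (- 1ℝ) x ⟩
  - 1ℝ * alt x            ≈⟨ -1*x≈-x (alt x) ⟩
  - alt x                 ∎

alt-zero : ∀ {n} {x : Fin n → ℝ} → (∀ i → x i ≈ 0ℝ) → alt x ≈ 0ℝ
alt-zero {x = x} x≈0 = begin
  alt x                ≈⟨ alt-cong (λ i → R.trans (x≈0 i) (R.sym (R.zeroˡ 0ℝ))) ⟩
  alt (λ _ → 0ℝ * 0ℝ)  ≈⟨ alt-* 0ℝ (λ _ → 0ℝ) ⟩
  0ℝ * alt (λ _ → 0ℝ)  ≈⟨ R.zeroˡ _ ⟩
  0ℝ                   ∎

alt-comm : ∀ {m n} (x : Fin m → Fin n → ℝ) → alt (λ i → alt (x i)) ≈ alt (λ j → alt (λ i → x i j))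
alt-comm {zero}  x = R.trans (alt-empty _) (R.sym (alt-zero λ _ → alt-empty _))
alt-comm {suc m} x = begin
  alt (λ i → alt (x i))                                 ≈⟨ alt-suc _ ⟩
  alt (x zero) - alt (λ i → alt (x (suc i)))            ≈⟨ R.+-congˡ (R.-‿cong (alt-comm (x ∘ suc))) ⟩
  alt (x zero) - alt (λ j → alt (λ i → x (suc i) j))    ≈⟨ R.+-congˡ (alt-neg _) ⟨
  alt (x zero) + alt (λ j → - alt (λ i → x (suc i) j))  ≈⟨ alt-+ (x zero) _ ⟨
  alt (λ j → x zero j - alt (λ i → x (suc i) j))        ≈⟨ alt-cong (λ j → alt-suc _) ⟨
  alt (λ j → alt (λ i → x i j))                         ∎

*-exchange : ∀ x y z → x * (y * z) ≈ y * (x * z)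
*-exchange x y z = ≗⇒≈ λ n → solve 3 (λ x y z → x :* (y :* z) := y :* (x :* z)) refl (seq x n) (seq y n) (seq z n)
  where open ℚ.+-*-Solver

-- Needed wherever a row expansion and a column expansion are nested: with `D i j` the complementary
-- minors, it changes which of the two is done first.
alt-exchange : ∀ {m n} (u : Fin m → ℝ) (w : Fin n → ℝ) (D : Fin m → Fin n → ℝ) →
               alt (λ j → w j * alt (λ i → u i * D i j)) ≈ alt (λ i → u i * alt (λ j → w j * D i j))
alt-exchange u w D = begin
  alt (λ j → w j * alt (λ i → u i * D i j))      ≈⟨ alt-cong (λ j → alt-* (w j) _) ⟨
  alt (λ j → alt (λ i → w j * (u i * D i j)))    ≈⟨ alt-comm _ ⟩
  alt (λ i → alt (λ j → w j * (u i * D i j)))    ≈⟨ alt-cong (λ i → alt-cong λ j → *-exchange (w j) (u i) (D i j)) ⟩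
  alt (λ i → alt (λ j → u i * (w j * D i j)))    ≈⟨ alt-cong (λ i → alt-* (u i) _) ⟩
  alt (λ i → u i * alt (λ j → w j * D i j))      ∎

signedSum≈alt : ∀ {n} (x : Fin n → ℝ) → ∑[ j < n ] ((- 1ℝ) ^ toℕ j * x j) ≈ alt x
signedSum≈alt {zero}  x = R.sym (alt-empty x)
signedSum≈alt {suc n} x = begin
  1ℝ * x zero + ∑[ j < n ] ((- 1ℝ) * (- 1ℝ) ^ toℕ j * x (suc j))    ≈⟨ R.+-cong (R.*-identityˡ (x zero)) (sum-cong-≋ {n} λ j → R.*-assoc (- 1ℝ) ((- 1ℝ) ^ toℕ j) (x (suc j))) ⟩
  x zero + ∑[ j < n ] ((- 1ℝ) * ((- 1ℝ) ^ toℕ j * x (suc j)))       ≈⟨ R.+-congˡ (*-distribˡ-sum {n} (- 1ℝ) _) ⟨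
  x zero + - 1ℝ * ∑[ j < n ] ((- 1ℝ) ^ toℕ j * x (suc j))           ≈⟨ R.+-congˡ (-1*x≈-x _) ⟩
  x zero - ∑[ j < n ] ((- 1ℝ) ^ toℕ j * x (suc j))                  ≈⟨ R.+-congˡ (R.-‿cong (signedSum≈alt (x ∘ suc))) ⟩
  x zero - alt (x ∘ suc)                                            ≈⟨ alt-suc x ⟨
  alt x                                                             ∎

-- Determinants

SquareMatrix : ℕ → Set
SquareMatrix k = Fin k → Fin k → ℝ

-- Signs come from the repeated subtraction in `alt`, which keeps powers of -1 out of the inductions
-- below.
detᵃ : ∀ {k} → SquareMatrix k → ℝ
detᵃ {zero}  A = 1ℝ
detᵃ {suc k} A = alt λ j → A zero j * detᵃ (λ i l → A (suc i) (punchIn j l))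

det≈detᵃ : ∀ {k} (A : SquareMatrix k) → det A ≈ detᵃ A
det≈detᵃ {zero}  A = R.refl
det≈detᵃ {suc k} A = R.trans
  (sum-cong-≋ {suc k} λ j → R.trans (R.*-assoc ((- 1ℝ) ^ toℕ j) (A zero j) _)
    (R.*-congˡ {(- 1ℝ) ^ toℕ j} (R.*-congˡ {A zero j} (det≈detᵃ (minor j)))))
  (signedSum≈alt λ j → A zero j * detᵃ (minor j))
  where
  minor : Fin (suc k) → SquareMatrix k
  minor j i l = A (suc i) (punchIn j l)

detᵃ-cong : ∀ {k} {A B : SquareMatrix k} → (∀ i j → A i j ≈ B i j) → detᵃ A ≈ detᵃ B
detᵃ-cong {zero}  A≈B = R.refl
detᵃ-cong {suc k} A≈B = alt-cong λ j → R.*-cong (A≈B zero j) (detᵃ-cong λ i l → A≈B (suc i) (punchIn j l))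

-- The corner entry contributes the same term to both expansions. In every other term of the row
-- expansion the minor still contains column 0; expanding it there by induction and exchanging the
-- two sums yields the rest of the column expansion.
detᵃ-expandColumn : ∀ {k} (A : SquareMatrix (suc k)) →
                    detᵃ A ≈ alt λ i → A i zero * detᵃ (λ a b → A (punchIn i a) (suc b))
detᵃ-expandColumn {zero}  A = R.trans (alt-suc _) (R.trans (R.+-congˡ (R.-‿cong
  (R.trans (alt-empty _) (R.sym (alt-empty _))))) (R.sym (alt-suc _)))
detᵃ-expandColumn {suc k} A = R.trans (alt-suc _) (R.trans (R.+-congˡ (R.-‿cong (begin
  alt (λ j → A zero (suc j) * detᵃ (λ i l → A (suc i) (punchIn (suc j) l)))
    ≈⟨ alt-cong (λ j → R.*-congˡ (detᵃ-expandColumn λ i l → A (suc i) (punchIn (suc j) l))) ⟩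
  alt (λ j → A zero (suc j) * alt (λ i → A (suc i) zero * detᵃ (λ a b → A (suc (punchIn i a)) (suc (punchIn j b)))))
    ≈⟨ alt-exchange (λ i → A (suc i) zero) (λ j → A zero (suc j)) _ ⟩
  alt (λ i → A (suc i) zero * alt (λ j → A zero (suc j) * detᵃ (λ a b → A (suc (punchIn i a)) (suc (punchIn j b)))))
    ∎))) (R.sym (alt-suc _)))

-- For F c the minor on the columns c of the remaining rows, this is the
-- expansion of a determinant along its first two rows a and b.
expand₂ : ∀ {n} (a b : Fin (2 ℕ.+ n) → ℝ) (F : (Fin n → Fin (2 ℕ.+ n)) → ℝ) → ℝ
expand₂ a b F = alt λ j → a j * alt λ l → b (punchIn j l) * F (punchIn j ∘ punchIn l)

-- Column selections built in different ways from `punchIn` and `Fin.lift` are only shown to agree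
-- pointwise, so functions of them must respect `≗`.
Congruent : ∀ {m n} → ((Fin m → Fin n) → ℝ) → Set
Congruent F = ∀ {c d} → c ≗ d → F c ≈ F d

expand₂-head : ∀ {n} → (Fin (2 ℕ.+ n) → ℝ) → ((Fin n → Fin (2 ℕ.+ n)) → ℝ) → ℝ
expand₂-head x F = alt λ l → x (suc l) * F (suc ∘ punchIn l)

expand₂-rest : ∀ {n} (a b : Fin (2 ℕ.+ n) → ℝ) (F : (Fin n → Fin (2 ℕ.+ n)) → ℝ) → ℝ
expand₂-rest a b F = alt λ j → a (suc j) * alt λ l → b (suc (punchIn j l)) * F (punchIn (suc j) ∘ punchIn (suc l))

-- The ordered pairs of columns are sorted by whether column 0 is used by the first row, by the
-- second, or by neither. The first two groups trade places, with opposite signs, when the rows are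
-- interchanged.
expand₂-split : ∀ {n} (a b : Fin (2 ℕ.+ n) → ℝ) F →
  expand₂ a b F ≈ a zero * expand₂-head b F - b zero * expand₂-head a F + expand₂-rest a b F
expand₂-split a b F = begin
  expand₂ a b F
    ≈⟨ R.trans (alt-suc _) (R.+-congˡ (R.-‿cong (alt-cong λ j → R.*-congˡ (alt-suc _)))) ⟩
  a zero * B - alt (λ j → a (suc j) * (b zero * G j - r j))
    ≈⟨ R.+-congˡ (R.-‿cong (alt-cong λ j → rearrange (a (suc j)) (b zero) (G j) (r j))) ⟩
  a zero * B - alt (λ j → b zero * (a (suc j) * G j) + - (a (suc j) * r j))
    ≈⟨ R.+-congˡ (R.-‿cong (alt-+ _ _)) ⟩
  a zero * B - (alt (λ j → b zero * (a (suc j) * G j)) + alt (λ j → - (a (suc j) * r j)))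
    ≈⟨ R.+-congˡ (R.-‿cong (R.+-cong (alt-* (b zero) _) (alt-neg _))) ⟩
  a zero * B - (b zero * A - C)
    ≈⟨ ≗⇒≈ (λ n → solve 3 (λ x y z → x :- (y :- z) := x :- y :+ z) refl (seq (a zero * B) n) (seq (b zero * A) n) (seq C n)) ⟩
  a zero * B - b zero * A + C ∎
  where
  open ℚ.+-*-Solver
  A B C : ℝ
  A = expand₂-head a F
  B = expand₂-head b F
  C = expand₂-rest a b F
  G r : Fin _ → ℝ
  G j = F (suc ∘ punchIn j)
  r j = alt λ l → b (suc (punchIn j l)) * F (punchIn (suc j) ∘ punchIn (suc l))
  rearrange : ∀ a b G r → a * (b * G - r) ≈ b * (a * G) + - (a * r)
  rearrange a b G r = ≗⇒≈ λ n →
    solve 4 (λ a b G r → a :* (b :* G :- r) := b :* (a :* G) :+ (:- (a :* r))) refl (seq a n) (seq b n) (seq G n) (seq r n)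

lift-congruent : ∀ {m n} {F : (Fin (suc m) → Fin (suc n)) → ℝ} → Congruent F → Congruent (F ∘ Fin.lift 1)
lift-congruent F-cong eq = F-cong λ { zero → refl ; (suc i) → cong suc (eq i) }

-- When neither row uses column 0, that column stays among those passed to `F`; `Fin.lift 1` keeps
-- it in front of a selection from the other columns. This is the descent step for the two
-- inductions that follow.
expand₂-rest-lift : ∀ {n} (a b : Fin (3 ℕ.+ n) → ℝ) {F} → Congruent F →
  expand₂-rest a b F ≈ expand₂ (a ∘ suc) (b ∘ suc) (F ∘ Fin.lift 1)
expand₂-rest-lift a b F-cong = alt-cong λ j → R.*-congˡ (alt-cong λ l →
  R.*-congˡ (F-cong λ { zero → refl ; (suc i) → refl }))

expand₂-rest-zero : (a b : Fin 2 → ℝ) (F : (Fin 0 → Fin 2) → ℝ) → expand₂-rest a b F ≈ 0ℝ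
expand₂-rest-zero a b F = alt-zero λ j → R.trans (R.*-congˡ (alt-empty _)) (R.zeroʳ (a (suc j)))

-- Induction on the number of columns: the two terms that use column 0 are antisymmetric by
-- inspection, and the rest is an expansion over one column fewer.
expand₂-swap : ∀ {n} (a b : Fin (2 ℕ.+ n) → ℝ) {F} → Congruent F → expand₂ a b F ≈ - expand₂ b a F
expand₂-swap {n} a b {F} F-cong = begin
  expand₂ a b F                                  ≈⟨ expand₂-split a b F ⟩
  x - y + expand₂-rest a b F                     ≈⟨ R.+-congˡ (rest n a b F-cong) ⟩
  x - y + - expand₂-rest b a F                   ≈⟨ ≗⇒≈ (λ n → solve 3 (λ x y z → x :- y :+ (:- z) := :- (y :- x :+ z)) refl (seq x n) (seq y n) (seq z n)) ⟩
  - (y - x + expand₂-rest b a F)                 ≈⟨ R.-‿cong (expand₂-split b a F) ⟨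
  - expand₂ b a F                                ∎
  where
  open ℚ.+-*-Solver
  x y z : ℝ
  x = a zero * expand₂-head b F
  y = b zero * expand₂-head a F
  z = expand₂-rest b a F
  rest : ∀ n (a b : Fin (2 ℕ.+ n) → ℝ) {F} → Congruent F → expand₂-rest a b F ≈ - expand₂-rest b a F
  rest zero a b {F} _ = R.trans (expand₂-rest-zero a b F)
    (R.trans (≗⇒≈ λ _ → refl) (R.-‿cong (R.sym (expand₂-rest-zero b a F))))
  rest (suc n) a b {F} F-cong = begin
    expand₂-rest a b F                                   ≈⟨ expand₂-rest-lift a b F-cong ⟩
    expand₂ (a ∘ suc) (b ∘ suc) (F ∘ Fin.lift 1)         ≈⟨ expand₂-swap (a ∘ suc) (b ∘ suc) (lift-congruent {F = F} F-cong) ⟩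
    - expand₂ (b ∘ suc) (a ∘ suc) (F ∘ Fin.lift 1)       ≈⟨ R.-‿cong (expand₂-rest-lift b a F-cong) ⟨
    - expand₂-rest b a F                                 ∎

-- The two terms that use column 0 cancel, and the rest vanishes by induction. Proving this directly
-- avoids dividing by 2, as a derivation from antisymmetry would.
expand₂-diagonal : ∀ {n} (a : Fin (2 ℕ.+ n) → ℝ) {F} → Congruent F → expand₂ a a F ≈ 0ℝ
expand₂-diagonal {n} a {F} F-cong = begin
  expand₂ a a F                   ≈⟨ expand₂-split a a F ⟩
  x - x + expand₂-rest a a F      ≈⟨ R.+-cong (R.-‿inverseʳ x) (rest n a F-cong) ⟩
  0ℝ + 0ℝ                         ≈⟨ R.+-identityʳ 0ℝ ⟩
  0ℝ                              ∎
  where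
  x : ℝ
  x = a zero * expand₂-head a F
  rest : ∀ n (a : Fin (2 ℕ.+ n) → ℝ) {F} → Congruent F → expand₂-rest a a F ≈ 0ℝ
  rest zero    a {F} _      = expand₂-rest-zero a a F
  rest (suc n) a {F} F-cong =
    R.trans (expand₂-rest-lift a a F-cong) (expand₂-diagonal (a ∘ suc) (lift-congruent {F = F} F-cong))

columns-congruent : ∀ {k n} (X : Fin k → Fin n → ℝ) → Congruent (λ c → detᵃ (λ i l → X i (c l)))
columns-congruent X c≗d = detᵃ-cong λ i l → R.reflexive (cong (X i) (c≗d l))

-- `detᵃ (v ∷ w ∷ X)` unfolds definitionally to `expand₂ v w`, applied to the minors of `X`.
detᵃ-swap : ∀ {k} (v w : Fin (2 ℕ.+ k) → ℝ) X → detᵃ (v ∷ w ∷ X) ≈ - detᵃ (w ∷ v ∷ X)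
detᵃ-swap v w X = expand₂-swap v w (columns-congruent X)

detᵃ-equalRows : ∀ {k} (v : Fin (2 ℕ.+ k) → ℝ) X → detᵃ (v ∷ v ∷ X) ≈ 0ℝ
detᵃ-equalRows v X = expand₂-diagonal v (columns-congruent X)

-- A division-free matrix determinant lemma. In the correction term row `i` of `M` is deleted and
-- `v` placed on top; the alternating sign accounts for moving `v` from position `i`. Only one row
-- can contribute `v`, since two equal rows give 0.
detᵃ-rankOne : ∀ {k} (u v : Fin (suc k) → ℝ) (M : SquareMatrix (suc k)) →
  detᵃ (λ i j → u i * v j + M i j) ≈ detᵃ M + alt (λ i → u i * detᵃ (v ∷ (M ∘ punchIn i)))
detᵃ-rankOne {zero} u v M = R.trans (alt-singleton _) (R.trans (≗⇒≈ λ n →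
  solve 3 (λ a b m → (a :* b :+ m) :* con 1ℚ := m :* con 1ℚ :+ a :* (b :* con 1ℚ)) refl
    (seq (u zero) n) (seq (v zero) n) (seq (M zero zero) n))
  (R.sym (R.+-cong (alt-singleton _) (R.trans (alt-singleton _) (R.*-congˡ (alt-singleton _))))))
  where open ℚ.+-*-Solver
detᵃ-rankOne {suc k} u v M = begin
  alt (λ j → (u zero * v j + M zero j) * N j)
    ≈⟨ alt-cong (λ j → distrib (u zero) (v j) (M zero j) (N j)) ⟩
  alt (λ j → u zero * (v j * N j) + M zero j * N j)
    ≈⟨ alt-+ _ _ ⟩
  alt (λ j → u zero * (v j * N j)) + alt (λ j → M zero j * N j)
    ≈⟨ R.+-congʳ (alt-* (u zero) _) ⟩
  u zero * alt (λ j → v j * N j) + alt (λ j → M zero j * N j)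
    ≈⟨ R.+-cong (R.*-congˡ (expandRow v)) (expandRow (M zero)) ⟩
  u zero * (detᵃ (v ∷ M′) + alt (λ i → u (suc i) * detᵃ (v ∷ v ∷ (M′ ∘ punchIn i))))
    + (detᵃ M + alt (λ i → u (suc i) * detᵃ (M zero ∷ v ∷ (M′ ∘ punchIn i))))
    -- With `v` as top row, a second `v` below it kills the correction. With `M zero` as top row,
    -- swapping it with `v` produces the minus sign that `alt` expects on its tail.
    ≈⟨ R.+-cong (R.*-congˡ (R.+-congˡ (alt-zero λ i → R.trans (R.*-congˡ (detᵃ-equalRows v (M′ ∘ punchIn i))) (R.zeroʳ _))))
                (R.+-congˡ (alt-cong λ i → R.*-congˡ (detᵃ-swap (M zero) v (M′ ∘ punchIn i)))) ⟩
  u zero * (detᵃ (v ∷ M′) + 0ℝ) + (detᵃ M + alt (λ i → u (suc i) * - D i))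
    ≈⟨ R.+-congˡ (R.+-congˡ (R.trans (alt-cong λ i → R.sym (-‿distribʳ-* (u (suc i)) (D i))) (alt-neg _))) ⟩
  u zero * (detᵃ (v ∷ M′) + 0ℝ) + (detᵃ M - alt (λ i → u (suc i) * D i))
    ≈⟨ ≗⇒≈ (λ n → solve 4 (λ a b c d → a :* (b :+ con 0ℚ) :+ (c :- d) := c :+ (a :* b :- d)) refl
         (seq (u zero) n) (seq (detᵃ (v ∷ M′)) n) (seq (detᵃ M) n) (seq (alt (λ i → u (suc i) * D i)) n)) ⟩
  detᵃ M + (u zero * detᵃ (v ∷ M′) - alt (λ i → u (suc i) * D i))
    ≈⟨ R.+-congˡ (alt-suc _) ⟨
  detᵃ M + alt (λ i → u i * detᵃ (v ∷ (M ∘ punchIn i)))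
    ∎
  where
  open ℚ.+-*-Solver
  M′ : Fin (suc k) → Fin (2 ℕ.+ k) → ℝ
  M′ i = M (suc i)
  N : Fin (2 ℕ.+ k) → ℝ
  N j = detᵃ λ i l → u (suc i) * v (punchIn j l) + M′ i (punchIn j l)
  D : Fin (suc k) → ℝ
  D i = detᵃ (v ∷ M zero ∷ (M′ ∘ punchIn i))
  distrib : ∀ a b c d → (a * b + c) * d ≈ a * (b * d) + c * d
  distrib a b c d = ≗⇒≈ λ n → solve 4 (λ a b c d → (a :* b :+ c) :* d := a :* (b :* d) :+ c :* d) refl
    (seq a n) (seq b n) (seq c n) (seq d n)
  -- `w` is either summand of the top row, `v` or `M zero`; the lower rows carry the rank-one
  -- update, to which the induction hypothesis applies minor by minor.
  expandRow : ∀ w → alt (λ j → w j * N j) ≈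
    detᵃ (w ∷ M′) + alt (λ i → u (suc i) * detᵃ (w ∷ v ∷ (M′ ∘ punchIn i)))
  expandRow w = begin
    alt (λ j → w j * N j)
      ≈⟨ alt-cong (λ j → R.trans (R.*-congˡ (detᵃ-rankOne (u ∘ suc) (v ∘ punchIn j) λ i l → M′ i (punchIn j l))) (R.distribˡ (w j) _ _)) ⟩
    alt (λ j → w j * detᵃ (λ i l → M′ i (punchIn j l)) + w j * alt (λ i → u (suc i) * E i j))
      ≈⟨ alt-+ _ _ ⟩
    detᵃ (w ∷ M′) + alt (λ j → w j * alt (λ i → u (suc i) * E i j))
      ≈⟨ R.+-congˡ (alt-exchange (u ∘ suc) w E) ⟩
    detᵃ (w ∷ M′) + alt (λ i → u (suc i) * alt (λ j → w j * E i j))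
      ∎
    where
    E : Fin (suc k) → Fin (2 ℕ.+ k) → ℝ
    E i j = detᵃ ((v ∘ punchIn j) ∷ λ a l → M′ (punchIn i a) (punchIn j l))

-- The Cauchy–Binet formula

-- The sum of Φ s over the increasing sequences 0 ≤ s₀ < … < sₖ₋₁ < N,
-- split according to whether s₀ is 0.
∑↑ : ∀ (N k : ℕ) → ((Fin k → ℕ) → ℝ) → ℝ
∑↑ N       zero    Φ = Φ []
∑↑ zero    (suc k) Φ = 0ℝ
∑↑ (suc N) (suc k) Φ = ∑↑ N k (λ s → Φ (0 ∷ (suc ∘ s))) + ∑↑ N (suc k) (λ s → Φ (suc ∘ s))

∑↑-cong : ∀ N k {Φ Ψ : (Fin k → ℕ) → ℝ} → (∀ s → Φ s ≈ Ψ s) → ∑↑ N k Φ ≈ ∑↑ N k Ψ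
∑↑-cong N       zero    eq = eq []
∑↑-cong zero    (suc k) eq = R.refl
∑↑-cong (suc N) (suc k) eq = R.+-cong (∑↑-cong N k λ _ → eq _) (∑↑-cong N (suc k) λ _ → eq _)

∑↑-zero : ∀ N k → ∑↑ N k (λ _ → 0ℝ) ≈ 0ℝ
∑↑-zero N       zero    = R.refl
∑↑-zero zero    (suc k) = R.refl
∑↑-zero (suc N) (suc k) = R.trans (R.+-cong (∑↑-zero N k) (∑↑-zero N (suc k))) (R.+-identityʳ 0ℝ)

-- The combination `c * Φ s - Ψ s` is exactly one unfolding of `alt`, as needed for the induction in
-- `alt-∑↑`.
∑↑-linear : ∀ N k c (Φ Ψ : (Fin k → ℕ) → ℝ) →
            ∑↑ N k (λ s → c * Φ s - Ψ s) ≈ c * ∑↑ N k Φ - ∑↑ N k Ψ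
∑↑-linear N       zero    c Φ Ψ = R.refl
∑↑-linear zero    (suc k) c Φ Ψ = ≗⇒≈ λ n →
  solve 1 (λ c → con 0ℚ := c :* con 0ℚ :- con 0ℚ) refl (seq c n)
  where open ℚ.+-*-Solver
∑↑-linear (suc N) (suc k) c Φ Ψ = R.trans (R.+-cong (∑↑-linear N k c _ _) (∑↑-linear N (suc k) c _ _))
  (≗⇒≈ λ n → solve 5 (λ c x y x′ y′ → c :* x :- y :+ (c :* x′ :- y′) := c :* (x :+ x′) :- (y :+ y′)) refl
    (seq c n) (seq (∑↑ N k λ s → Φ (0 ∷ (suc ∘ s))) n) (seq (∑↑ N k λ s → Ψ (0 ∷ (suc ∘ s))) n)
    (seq (∑↑ N (suc k) λ s → Φ (suc ∘ s)) n) (seq (∑↑ N (suc k) λ s → Ψ (suc ∘ s)) n))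
  where open ℚ.+-*-Solver

alt-∑↑ : ∀ N k {m} (b : Fin m → ℝ) (Φ : Fin m → (Fin k → ℕ) → ℝ) →
         alt (λ j → b j * ∑↑ N k (Φ j)) ≈ ∑↑ N k (λ s → alt λ j → b j * Φ j s)
alt-∑↑ N k {zero}  b Φ = R.trans (alt-empty _)
  (R.sym (R.trans (∑↑-cong N k λ _ → alt-empty _) (∑↑-zero N k)))
alt-∑↑ N k {suc m} b Φ = begin
  alt (λ j → b j * ∑↑ N k (Φ j))                                                     ≈⟨ alt-suc _ ⟩
  b zero * ∑↑ N k (Φ zero) - alt (λ j → b (suc j) * ∑↑ N k (Φ (suc j)))               ≈⟨ R.+-congˡ (R.-‿cong (alt-∑↑ N k (b ∘ suc) (Φ ∘ suc))) ⟩
  b zero * ∑↑ N k (Φ zero) - ∑↑ N k (λ s → alt λ j → b (suc j) * Φ (suc j) s)         ≈⟨ ∑↑-linear N k (b zero) (Φ zero) _ ⟨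
  ∑↑ N k (λ s → b zero * Φ zero s - alt (λ j → b (suc j) * Φ (suc j) s))              ≈⟨ ∑↑-cong N k (λ s → alt-suc _) ⟨
  ∑↑ N k (λ s → alt λ j → b j * Φ j s)                                               ∎

-- In the correction term of the rank-one update, this separates the expansion of a minor of `A`
-- from that of a minor of `B`.
alt-product : ∀ {m n} (a P : Fin m → ℝ) (b Q : Fin n → ℝ) →
              alt (λ i → a i * alt (λ j → b j * (P i * Q j))) ≈ alt (λ i → a i * P i) * alt (λ j → b j * Q j)
alt-product a P b Q = begin
  alt (λ i → a i * alt (λ j → b j * (P i * Q j)))
    ≈⟨ alt-cong (λ i → R.*-congˡ (R.trans (alt-cong λ j → *-exchange (b j) (P i) (Q j)) (alt-* (P i) _))) ⟩
  alt (λ i → a i * (P i * q))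
    ≈⟨ alt-cong (λ i → R.trans (R.sym (R.*-assoc (a i) (P i) q)) (R.*-comm _ q)) ⟩
  alt (λ i → q * (a i * P i))
    ≈⟨ alt-* q _ ⟩
  q * alt (λ i → a i * P i)
    ≈⟨ R.*-comm q _ ⟩
  alt (λ i → a i * P i) * q ∎
  where q = alt λ j → b j * Q j

-- Here `detᵃ M` accounts for the index sets avoiding 0. The minors of `M` in the correction term
-- are one size smaller and use one inner index fewer; expanding them by induction and regrouping
-- gives the index sets containing 0.
cauchyBinet : ∀ N {k} (A : Fin k → ℕ → ℝ) (B : ℕ → Fin k → ℝ) →
  detᵃ (λ i j → ∑[ n < N ] (A i (toℕ n) * B (toℕ n) j)) ≈
  ∑↑ N k (λ s → detᵃ (λ i j → A i (s j)) * detᵃ (λ i j → B (s i) j))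
cauchyBinet N       {zero}  A B = R.sym (R.*-identityˡ 1ℝ)
cauchyBinet zero    {suc k} A B = alt-zero λ j → R.zeroˡ _
cauchyBinet (suc N) {suc k} A B = begin
  detᵃ (λ i j → A i 0 * B 0 j + M i j)
    ≈⟨ detᵃ-rankOne (λ i → A i 0) (B 0) M ⟩
  detᵃ M + alt (λ i → A i 0 * alt (λ j → B 0 j * detᵃ (λ a l → M (punchIn i a) (punchIn j l))))
    ≈⟨ R.+-congˡ (alt-cong λ i → R.*-congˡ (R.trans
         (alt-cong λ j → R.*-congˡ (cauchyBinet N (λ a n → A (punchIn i a) (suc n)) (λ n l → B (suc n) (punchIn j l))))
         (alt-∑↑ N k (B 0) _))) ⟩
  detᵃ M + alt (λ i → A i 0 * ∑↑ N k (λ s → alt (λ j → B 0 j * (P i s * Q j s))))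
    ≈⟨ R.+-congˡ (alt-∑↑ N k (λ i → A i 0) _) ⟩
  detᵃ M + ∑↑ N k (λ s → alt (λ i → A i 0 * alt (λ j → B 0 j * (P i s * Q j s))))
    -- The first factor is an expansion along column 0; the second is already a determinant, being
    -- by definition its expansion along row 0.
    ≈⟨ R.+-congˡ (∑↑-cong N k λ s → R.trans (alt-product (λ i → A i 0) (λ i → P i s) (B 0) (λ j → Q j s))
         (R.*-congʳ (R.sym (detᵃ-expandColumn (λ i j → A i ((0 ∷ (suc ∘ s)) j)))))) ⟩
  detᵃ M + ∑↑ N k (λ s → detᵃ (λ i j → A i ((0 ∷ (suc ∘ s)) j)) * detᵃ (λ i j → B ((0 ∷ (suc ∘ s)) i) j))
    ≈⟨ R.+-comm _ _ ⟩
  ∑↑ N k (λ s → detᵃ (λ i j → A i ((0 ∷ (suc ∘ s)) j)) * detᵃ (λ i j → B ((0 ∷ (suc ∘ s)) i) j)) + detᵃ M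
    ≈⟨ R.+-congˡ (cauchyBinet N (λ i n → A i (suc n)) (λ n j → B (suc n) j)) ⟩
  ∑↑ (suc N) (suc k) (λ s → detᵃ (λ i j → A i (s j)) * detᵃ (λ i j → B (s i) j))
    ∎
  where
  M : SquareMatrix (suc k)
  M i j = ∑[ n < N ] (A i (suc (toℕ n)) * B (suc (toℕ n)) j)
  P Q : Fin (suc k) → (Fin k → ℕ) → ℝ
  P i s = detᵃ λ a b → A (punchIn i a) (suc (s b))
  Q j s = detᵃ λ a l → B (suc (s a)) (punchIn j l)

-- Total positivity from a production matrix

∷-increasing : ∀ {k} {s : Fin k → ℕ} → StrictlyIncreasing s → StrictlyIncreasing (0 ∷ (suc ∘ s))
∷-increasing s↑ {zero}  {suc j} _         = s≤s z≤n
∷-increasing s↑ {suc i} {suc j} (s≤s i<j) = s≤s (s↑ i<j)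

∑↑-nonneg : ∀ N k {Φ : (Fin k → ℕ) → ℝ} → (∀ s → StrictlyIncreasing s → 0ℝ ≤ Φ s) → 0ℝ ≤ ∑↑ N k Φ
∑↑-nonneg N       zero    0≤Φ = 0≤Φ [] λ {}
∑↑-nonneg zero    (suc k) 0≤Φ = 0≤0
∑↑-nonneg (suc N) (suc k) 0≤Φ = 0≤-+
  (∑↑-nonneg N k λ s s↑ → 0≤Φ _ (∷-increasing s↑))
  (∑↑-nonneg N (suc k) λ s s↑ → 0≤Φ _ λ i<j → s≤s (s↑ i<j))

bound : ∀ {k} (r : Fin k → ℕ) → ∃ λ b → ∀ i → r i ℕ.< b
bound {zero}  r = 0 , λ ()
bound {suc k} r with bound (r ∘ suc)
... | b , r<b = suc (r zero) ℕ.⊔ b , λ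
  { zero    → ℕ.m≤m⊔n (suc (r zero)) b
  ; (suc i) → ℕ.≤-trans (r<b i) (ℕ.m≤n⊔m (suc (r zero)) b) }

-- The recurrence is truncated at a bound common to all rows below `b`, so that one finite
-- Cauchy-Binet formula applies to all selected rows at once.
production⇒totallyPositive : (A J : Matrix) → 0ℝ ≤ A 0 0 → (∀ m → A 0 (suc m) ≈ 0ℝ) →
  (∀ b n → n ℕ.< b → ∀ m → A (suc n) m ≈ ∑[ l < suc b ] (A n (toℕ l) * J (toℕ l) m)) →
  TotallyPositive J → TotallyPositive A
production⇒totallyPositive A J 0≤A₀₀ A₀≈0 A-rec J-tp rows cols rows↑ cols↑ with bound rows
... | b , rows<b = 0≤-resp-≈ (R.sym (det≈detᵃ λ i j → A (rows i) (cols j))) (nonneg b rows cols rows↑ cols↑ rows<b)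
  where
  -- Columns and size are left free: Cauchy-Binet replaces the columns by inner indices, and
  -- splitting off row 0 lowers the size.
  Nonneg : ℕ → Set
  Nonneg b = ∀ {k} (rows cols : Fin k → ℕ) → StrictlyIncreasing rows → StrictlyIncreasing cols →
    (∀ i → rows i ℕ.< b) → 0ℝ ≤ detᵃ (λ i j → A (rows i) (cols j))

  0≤A₀ : ∀ m → 0ℝ ≤ A 0 m
  0≤A₀ zero    = 0≤A₀₀
  0≤A₀ (suc m) = 0≤-resp-≈ (R.sym (A₀≈0 m)) 0≤0

  A₀-vanishes : ∀ {m} → 0 ℕ.< m → A 0 m ≈ 0ℝ
  A₀-vanishes {suc m} _ = A₀≈0 m

  step : ∀ b → Nonneg b → ∀ {k} (rows cols : Fin k → ℕ) → StrictlyIncreasing rows → StrictlyIncreasing cols →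
         (∀ i → 0 ℕ.< rows i) → (∀ i → rows i ℕ.< suc b) → 0ℝ ≤ detᵃ (λ i j → A (rows i) (cols j))
  step b ih {k} rows cols rows↑ cols↑ 0<rows rows<1+b =
    0≤-resp-≈ (R.sym (R.trans (detᵃ-cong entry) (cauchyBinet (suc b) (A ∘ r) (λ l j → J l (cols j)))))
      (∑↑-nonneg (suc b) k λ s s↑ → 0≤-* (ih r s r↑ s↑ r<b)
        (0≤-resp-≈ (det≈detᵃ λ i j → J (s i) (cols j)) (J-tp s cols s↑ cols↑)))
    where
    r : Fin k → ℕ
    r = ℕ.pred ∘ rows
    suc-r : ∀ i → suc (r i) ≡ rows i
    suc-r i = ℕ.suc-pred (rows i) {{ℕ.>-nonZero (0<rows i)}}
    r↑ : StrictlyIncreasing r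
    r↑ {i} {j} i<j = ℕ.s≤s⁻¹ (subst₂ ℕ._<_ (sym (suc-r i)) (sym (suc-r j)) (rows↑ i<j))
    r<b : ∀ i → r i ℕ.< b
    r<b i = ℕ.s≤s⁻¹ (subst (ℕ._< suc b) (sym (suc-r i)) (rows<1+b i))
    entry : ∀ i j → A (rows i) (cols j) ≈ ∑[ l < suc b ] (A (r i) (toℕ l) * J (toℕ l) (cols j))
    entry i j = R.trans (R.reflexive (cong (λ n → A n (cols j)) (sym (suc-r i)))) (A-rec b (r i) (r<b i) (cols j))

  nonneg : ∀ b → Nonneg b
  nonneg b       {zero}  rows cols rows↑ cols↑ rows<b = 0≤1
  nonneg zero    {suc k} rows cols rows↑ cols↑ rows<b with () ← rows<b zero
  nonneg (suc b) {suc k} rows cols rows↑ cols↑ rows<b with rows zero ℕ.≟ 0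
  ... | no r₀≢0 = step b (nonneg b) rows cols rows↑ cols↑ 0<rows rows<b
    where
    0<rows : ∀ i → 0 ℕ.< rows i
    0<rows zero    = ℕ.n≢0⇒n>0 r₀≢0
    0<rows (suc i) = ℕ.≤-<-trans z≤n (rows↑ {zero} {suc i} (s≤s z≤n))
  ... | yes r₀≡0 = 0≤-resp-≈ (R.sym expand) (0≤-* (0≤A₀ (cols zero)) rest)
    where
    D : Fin (suc k) → ℝ
    D j = detᵃ λ i l → A (rows (suc i)) (cols (punchIn j l))
    rest : 0ℝ ≤ D zero
    rest = step b (nonneg b) (rows ∘ suc) (cols ∘ suc) (λ i<j → rows↑ (s≤s i<j)) (λ i<j → cols↑ (s≤s i<j))
      (λ i → ℕ.≤-<-trans z≤n (rows↑ {zero} {suc i} (s≤s z≤n))) (rows<b ∘ suc)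
    -- Selected columns after the first are positive, and there row 0 of `A` vanishes. If the first
    -- is positive too, the surviving factor is itself 0. The remaining rows are positive, so `step`
    -- handles `D zero`.
    expand : alt (λ j → A (rows zero) (cols j) * D j) ≈ A 0 (cols zero) * D zero
    expand = begin
      alt (λ j → A (rows zero) (cols j) * D j)
        ≡⟨ cong (λ r → alt (λ j → A r (cols j) * D j)) r₀≡0 ⟩
      alt (λ j → A 0 (cols j) * D j)
        ≈⟨ alt-suc _ ⟩
      A 0 (cols zero) * D zero - alt (λ j → A 0 (cols (suc j)) * D (suc j))
        ≈⟨ R.+-congˡ (R.-‿cong (alt-zero λ j → R.trans
             (R.*-congʳ (A₀-vanishes (ℕ.≤-<-trans z≤n (cols↑ {zero} {suc j} (s≤s z≤n))))) (R.zeroˡ _))) ⟩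
      A 0 (cols zero) * D zero - 0ℝ
        ≈⟨ ≗⇒≈ (λ n → ℚ.+-identityʳ _) ⟩
      A 0 (cols zero) * D zero
        ∎

-- The production matrix of a quasi-Riordan array

sum-zero : ∀ {n} {x : Fin n → ℝ} → (∀ i → x i ≈ 0ℝ) → sum x ≈ 0ℝ
sum-zero {n} x≈0 = R.trans (sum-cong-≋ x≈0) (sum-replicate-zero n)

-- The vanishing hypothesis covers the case where `p` lies outside the range of summation: the sum
-- is then 0, and so is `a p`.
sum-indicator : ∀ N (a : ℕ → ℝ) p → (∀ l → N ℕ.≤ l → a l ≈ 0ℝ) →
                ∑[ l < N ] (a (toℕ l) * (if toℕ l ≡ᵇ p then 1ℝ else 0ℝ)) ≈ a p
sum-indicator zero    a p       a≈0 = R.sym (a≈0 p z≤n)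
sum-indicator (suc N) a zero    a≈0 = R.trans
  (R.+-cong (R.*-identityʳ (a 0)) (sum-zero {N} λ l → R.zeroʳ (a (suc (toℕ l))))) (R.+-identityʳ (a 0))
sum-indicator (suc N) a (suc p) a≈0 = R.trans
  (R.+-cong (R.zeroʳ (a 0)) (sum-indicator N (a ∘ suc) p λ l N≤l → a≈0 (suc l) (s≤s N≤l))) (R.+-identityˡ (a (suc p)))

const-*ₛ : ∀ c (a : Series) n → (const c *ₛ a) n ≈ c * a n
const-*ₛ c a n = R.trans (R.+-congˡ (sum-zero {n} λ i → R.zeroˡ _)) (R.+-identityʳ (c * a n))

linear-*ₛ : ∀ (h a : Series) → (∀ k → h (2 ℕ.+ k) ≈ 0ℝ) → ∀ n → (h *ₛ a) (suc n) ≈ h 0 * a (suc n) + h 1 * a n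
linear-*ₛ h a h≈0 n = R.+-congˡ (R.trans
  (R.+-congˡ (sum-zero {n} λ i → R.trans (R.*-congʳ (h≈0 (toℕ i))) (R.zeroˡ _))) (R.+-identityʳ (h 1 * a n)))

-- Columns from 1 on form a Toeplitz matrix. The split on `k` is there only to let `_≤ᵇ_` compute.
quasiRiordan-suc : ∀ g f n k → quasiRiordan g f (suc n) (2 ℕ.+ k) ≡ quasiRiordan g f n (suc k)
quasiRiordan-suc g f n zero    = refl
quasiRiordan-suc g f n (suc k) = refl

quasiRiordan-upper : ∀ g f {n k} → n ℕ.< k → quasiRiordan g f n (suc k) ≈ 0ℝ
quasiRiordan-upper g f {zero}  {suc k} _         = R.refl
quasiRiordan-upper g f {suc n} {suc k} (s≤s n<k) =
  R.trans (R.reflexive (quasiRiordan-suc g f n k)) (quasiRiordan-upper g f n<k)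

-- Columns from 1 on have generating functions f, tf, t²f, and so on, so combining them with weights
-- `b` multiplies f by `b`. Entries with `k > n` vanish, hence any `N > n` serves.
quasiRiordan-convolution : ∀ g f {n N} → n ℕ.< N → (b : Series) →
  ∑[ k < N ] (quasiRiordan g f n (suc (toℕ k)) * b (toℕ k)) ≈ (b *ₛ f) n
quasiRiordan-convolution g f {zero}  {suc N} _         b =
  R.+-cong (R.*-comm (f 0) (b 0)) (sum-zero {N} λ k → R.zeroˡ _)
quasiRiordan-convolution g f {suc n} {suc N} (s≤s n<N) b = R.+-cong (R.*-comm (f (suc n)) (b 0)) (R.trans
  (sum-cong-≋ {N} λ k → R.*-congʳ (R.reflexive (quasiRiordan-suc g f n (toℕ k))))
  (quasiRiordan-convolution g f n<N (b ∘ suc)))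

-- The common core of the Z and W columns, with `a` the numerator and `c` the added constant. Since
-- `a 1` vanishes, so does the constant term of the quotient `q`: the column of J starts with `c`,
-- and dropping that term makes coefficient `n` of `(q ∘ suc) *ₛ f` equal coefficient `suc n` of
-- `q *ₛ f`, which is `a (suc n)`.
quotient-column : ∀ g f (f₁#0 : f 1 # 0ℝ) → f 0 ≈ 0ℝ → ∀ a c → a 0 ≈ 0ℝ → a 1 ≈ 0ℝ → ∀ {n N} → n ℕ.< N →
  ∑[ l < suc N ] (quasiRiordan g f n (toℕ l) * (quotient a f f₁#0 +ₛ const c) (toℕ l)) ≈ g n * c + a (suc n)
quotient-column g f f₁#0 f₀≈0 a c a₀≈0 a₁≈0 {n} {N} n<N = R.+-cong
  (R.*-congˡ (R.trans (R.+-congʳ q₀≈0) (R.+-identityˡ c)))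
  (begin
    ∑[ k < N ] (quasiRiordan g f n (suc (toℕ k)) * (q (suc (toℕ k)) + 0ℝ))
      ≈⟨ sum-cong-≋ {N} (λ k → R.*-congˡ (R.+-identityʳ (q (suc (toℕ k))))) ⟩
    ∑[ k < N ] (quasiRiordan g f n (suc (toℕ k)) * q (suc (toℕ k)))
      ≈⟨ quasiRiordan-convolution g f n<N (q ∘ suc) ⟩
    ((q ∘ suc) *ₛ f) n
      ≈⟨ R.+-identityˡ _ ⟨
    0ℝ + ((q ∘ suc) *ₛ f) n
      ≈⟨ R.+-congʳ (R.trans (R.*-congʳ q₀≈0) (R.zeroˡ (f (suc n)))) ⟨
    (q *ₛ f) (suc n)
      ≈⟨ quotient-* a f f₁#0 a₀≈0 f₀≈0 (suc n) ⟩
    a (suc n)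
      ∎)
  where
  q : Series
  q = quotient a f f₁#0
  q₀≈0 : q 0 ≈ 0ℝ
  q₀≈0 = R.trans (R.*-congʳ a₁≈0) (R.zeroˡ _)

productionMatrix-generates : ∀ g f → g 0 ≈ 1ℝ → f 0 ≈ 0ℝ → (f₁#0 : f 1 # 0ℝ) → ∀ N n → n ℕ.< N → ∀ m →
  quasiRiordan g f (suc n) m ≈ ∑[ l < suc N ] (quasiRiordan g f n (toℕ l) * productionMatrix g f f₁#0 (toℕ l) m)
productionMatrix-generates g f g₀≈1 f₀≈0 f₁#0 N n n<N zero = R.sym (begin
  _                                     ≈⟨ quotient-column g f f₁#0 f₀≈0 a (g 1) a₀≈0 a₁≈0 n<N ⟩
  g n * g 1 + a (suc n)                 ≈⟨ R.+-congˡ (a-suc n) ⟩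
  g n * g 1 + (g (suc n) - g 1 * g n)   ≈⟨ ≗⇒≈ (λ k → solve 3 (λ x y z → x :* y :+ (z :- y :* x) := z) refl (seq (g n) k) (seq (g 1) k) (seq (g (suc n)) k)) ⟩
  g (suc n)                             ∎)
  where
  open ℚ.+-*-Solver
  h a : Series
  h = const 1ℝ -ₛ const (g 1) *ₛ 𝑡
  a = h *ₛ g -ₛ const 1ℝ
  h₀≈1 : h 0 ≈ 1ℝ
  h₀≈1 = R.trans (R.+-congˡ (R.-‿cong (const-*ₛ (g 1) 𝑡 0)))
    (≗⇒≈ λ k → solve 1 (λ x → con 1ℚ :- x :* con 0ℚ := con 1ℚ) refl (seq (g 1) k))
  h₁≈-g₁ : h 1 ≈ - g 1
  h₁≈-g₁ = R.trans (R.+-congˡ (R.-‿cong (const-*ₛ (g 1) 𝑡 1)))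
    (≗⇒≈ λ k → solve 1 (λ x → con 0ℚ :- x :* con 1ℚ := :- x) refl (seq (g 1) k))
  h≈0 : ∀ k → h (2 ℕ.+ k) ≈ 0ℝ
  h≈0 k = R.trans (R.+-congˡ (R.-‿cong (const-*ₛ (g 1) 𝑡 (2 ℕ.+ k))))
    (≗⇒≈ λ k → solve 1 (λ x → con 0ℚ :- x :* con 0ℚ := con 0ℚ) refl (seq (g 1) k))
  a₀≈0 : a 0 ≈ 0ℝ
  a₀≈0 = R.trans (R.+-congʳ (R.+-congʳ (R.*-cong h₀≈1 g₀≈1))) (≗⇒≈ λ _ → refl)
  a-suc : ∀ n → a (suc n) ≈ g (suc n) - g 1 * g n
  a-suc n = begin
    (h *ₛ g) (suc n) - 0ℝ                   ≈⟨ R.+-congʳ (linear-*ₛ h g h≈0 n) ⟩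
    h 0 * g (suc n) + h 1 * g n - 0ℝ        ≈⟨ R.+-congʳ (R.+-cong (R.*-congʳ h₀≈1) (R.*-congʳ h₁≈-g₁)) ⟩
    1ℝ * g (suc n) + - g 1 * g n - 0ℝ       ≈⟨ ≗⇒≈ (λ k → solve 3 (λ x y z → con 1ℚ :* x :+ (:- y) :* z :- con 0ℚ := x :- y :* z) refl (seq (g (suc n)) k) (seq (g 1) k) (seq (g n) k)) ⟩
    g (suc n) - g 1 * g n                   ∎
  -- The choice w₀ = g₁ is what cancels the linear coefficient of the numerator of W.
  a₁≈0 : a 1 ≈ 0ℝ
  a₁≈0 = begin
    a 1               ≈⟨ a-suc 0 ⟩
    g 1 - g 1 * g 0   ≈⟨ R.+-congˡ (R.-‿cong (R.*-congˡ g₀≈1)) ⟩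
    g 1 - g 1 * 1ℝ    ≈⟨ ≗⇒≈ (λ k → solve 1 (λ x → x :- x :* con 1ℚ := con 0ℚ) refl (seq (g 1) k)) ⟩
    0ℝ                ∎
productionMatrix-generates g f g₀≈1 f₀≈0 f₁#0 N n n<N (suc zero) = R.sym (begin
  _                                     ≈⟨ quotient-column g f f₁#0 f₀≈0 a (f 1) a₀≈0 a₁≈0 n<N ⟩
  g n * f 1 + a (suc n)                 ≈⟨ R.+-congˡ (a-suc n) ⟩
  g n * f 1 + (f (suc n) - f 1 * g n)   ≈⟨ ≗⇒≈ (λ k → solve 3 (λ x y z → x :* y :+ (z :- y :* x) := z) refl (seq (g n) k) (seq (f 1) k) (seq (f (suc n)) k)) ⟩
  f (suc n)                             ∎)
  where
  open ℚ.+-*-Solver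
  h a : Series
  h = const (f 1) *ₛ 𝑡
  a = f -ₛ h *ₛ g
  h₀≈0 : h 0 ≈ 0ℝ
  h₀≈0 = R.trans (const-*ₛ (f 1) 𝑡 0) (R.zeroʳ (f 1))
  h₁≈f₁ : h 1 ≈ f 1
  h₁≈f₁ = R.trans (const-*ₛ (f 1) 𝑡 1) (R.*-identityʳ (f 1))
  h≈0 : ∀ k → h (2 ℕ.+ k) ≈ 0ℝ
  h≈0 k = R.trans (const-*ₛ (f 1) 𝑡 (2 ℕ.+ k)) (R.zeroʳ (f 1))
  a₀≈0 : a 0 ≈ 0ℝ
  a₀≈0 = R.trans (R.+-cong f₀≈0 (R.-‿cong (R.+-congʳ (R.*-cong h₀≈0 g₀≈1)))) (≗⇒≈ λ _ → refl)
  a-suc : ∀ n → a (suc n) ≈ f (suc n) - f 1 * g n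
  a-suc n = R.+-congˡ (R.-‿cong (begin
    (h *ₛ g) (suc n)              ≈⟨ linear-*ₛ h g h≈0 n ⟩
    h 0 * g (suc n) + h 1 * g n   ≈⟨ R.+-cong (R.*-congʳ h₀≈0) (R.*-congʳ h₁≈f₁) ⟩
    0ℝ * g (suc n) + f 1 * g n    ≈⟨ R.+-congʳ (R.zeroˡ (g (suc n))) ⟩
    0ℝ + f 1 * g n                ≈⟨ R.+-identityˡ (f 1 * g n) ⟩
    f 1 * g n                     ∎))
  -- Likewise z₀ = f₁ cancels the linear coefficient of the numerator of Z.
  a₁≈0 : a 1 ≈ 0ℝ
  a₁≈0 = begin
    a 1               ≈⟨ a-suc 0 ⟩
    f 1 - f 1 * g 0   ≈⟨ R.+-congˡ (R.-‿cong (R.*-congˡ g₀≈1)) ⟩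
    f 1 - f 1 * 1ℝ    ≈⟨ ≗⇒≈ (λ k → solve 1 (λ x → x :- x :* con 1ℚ := con 0ℚ) refl (seq (f 1) k)) ⟩
    0ℝ                ∎
-- The single 1 in this column, in row `suc k`, selects the entry one step up the diagonal; past the
-- truncation that entry is 0 by triangularity.
productionMatrix-generates g f g₀≈1 f₀≈0 f₁#0 N n n<N (suc (suc k)) = R.sym (R.trans
  (sum-indicator (suc N) (quasiRiordan g f n) (suc k)
    λ { (suc l) (s≤s N≤l) → quasiRiordan-upper g f (ℕ.<-≤-trans n<N N≤l) })
  (R.reflexive (sym (quasiRiordan-suc g f n k))))

theorem3p2 : (g f : Series) → g 0 ≈ 1ℝ → f 0 ≈ 0ℝ → (f₁#0 : f 1 # 0ℝ) →
    TotallyPositive (productionMatrix g f f₁#0) → TotallyPositive (quasiRiordan g f)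
theorem3p2 g f g₀≈1 f₀≈0 f₁#0 = production⇒totallyPositive (quasiRiordan g f) (productionMatrix g f f₁#0)
  (0≤-resp-≈ (R.sym g₀≈1) 0≤1) row₀ (productionMatrix-generates g f g₀≈1 f₀≈0 f₁#0)
  where
  row₀ : ∀ m → quasiRiordan g f 0 (suc m) ≈ 0ℝ
  -- In row 0 the entry of column 1 is `f 0`; only from column 2 on does the zero branch of
  -- `quasiRiordan` apply.
  row₀ zero    = f₀≈0
  row₀ (suc m) = R.refl
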